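{- Let $G=(S,A,\delta,\mathcal{O},\gamma,s_0)$ be a POMDP with a parity objective $\mathsf{Parity}(p)$ with a set $D$ of $d$ priorities. The following assertions hold. (1) If there is a finite-memory positive winning strategy, then there is a positive winning strategy with memory of size at most $2^{3\cdot d\cdot|S|}$. (2) If there is a finite-memory almost-sure winning strategy, then there is an almost-sure winning strategy with memory of size at most $2^{3\cdot d\cdot|S|}$. (3) Finite-memory almost-sure (resp. positive) winning strategies require exponential memory in general, that is, there is a family $(G_n)_{n\ge1}$ of POMDPs of size polynomial in $n$ with parity objectives such that $G_n$ admits a finite-memory almost-sure (resp. positive) winning strategy, but every such strategy uses at least $2^{\Omega(n)}$ memory states. Moreover, belief-based stationary strategies are not sufficient in general: there is a POMDP with a parity objective that has a finite-memory almost-sure (resp. positive) winning strategy but no belief-based stationary almost-sure (resp. positive) winning strategy.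
   Context: For a finite set $X$, $\mathcal{D}(X)$ is the set of probability distributions on $X$ and $\mathrm{Supp}(f)$ the support of $f\in\mathcal{D}(X)$. A POMDP is a tuple $G=(S,A,\delta,\mathcal{O},\gamma,s_0)$ with a finite set $S$ of states, a finite set $A$ of actions, a transition function $\delta:S\times A\to\mathcal{D}(S)$, a finite set $\mathcal{O}$ of observations, an observation function $\gamma:S\to\mathcal{O}$, and an initial state $s_0\in S$. Standing assumption: $\gamma^{ -1}(\gamma(s_0))=\{s_0\}$. A finite-memory strategy is $\sigma=(\sigma_u,\sigma_n,M,m_0)$ with $M$ finite, $m_0\in M$, action selection $\sigma_n:M\to\mathcal{D}(A)$ and memory update $\sigma_u:M\times\mathcal{O}\times A\to\mathcal{D}(M)$; its memory size is $|M|$. It induces the finite Markov chain $G\restriction\sigma$ on $S\times M$ with $\delta_\sigma((s',m')\mid(s,m))=\sum_{a\in A}\sigma_n(m)(a)\cdot\delta(s,a)(s')\cdot\sigma_u(m,\gamma(s'),a)(m')$, started at $(s_0,m_0)$; $\mathbb{P}^\sigma$ is the induced probability measure on plays $(s_0,a_0,s_1,a_1,\dots)$. A priority function $p:S\to D$ maps states to non-negative integers, $D$ a finite set of non-negative integers; $\mathsf{Parity}(p)$ is the set of plays $\rho$ such that $\min\{p(s)\mid s\in\mathrm{Inf}(\rho)\}$ is even, where $\mathrm{Inf}(\rho)$ is the set of states occurring infinitely often in $\rho$. A strategy $\sigma$ is almost-sure (resp. positive) winning for $\varphi$ if $\mathbb{P}^\sigma(\varphi)=1$ (resp. $>0$).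 The belief is the set of states in which the POMDP can be given the observation-action history; it is initially $\{s_0\}$ and is updated from $Y$ on action $a$ and observation $o$ to $\bigcup_{s\in Y}\mathrm{Supp}(\delta(s,a))\cap\gamma^{ -1}(o)$. A (randomized) belief-based stationary strategy chooses a distribution over actions depending only on the current belief. -}

module Defs where

open import Algebra.Bundles using (CommutativeRing)
open import Data.Bool using (if_then_else_)
import Data.Bool.Properties as Bool
open import Data.Fin using (Fin; toℕ)
open import Data.Fin.Properties using (any?) renaming (_≟_ to _≟ᶠ_)
open import Data.Fin.Subset using (Subset; ⁅_⁆)
open import Data.Fin.Subset.Properties using (_∈?_)
open import Data.List using (List; []; _∷_; length; applyUpTo)
import Data.List.Membership.Propositional as List
open import Data.List.Relation.Unary.Unique.Propositional using (Unique)
open import Data.Maybe using (Maybe; just; maybe′)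
open import Data.Nat using (ℕ; suc; _^_) renaming (_≤_ to _≤ℕ_; _*_ to _*ℕ_)
open import Data.Nat.Divisibility using (_∣_)
open import Data.Product using (∃; _×_; _,_; proj₁)
open import Data.Vec using (tabulate)
import Data.Vec.Properties as Vec
open import Function using (_∘_)
open import Level using (0ℓ)
open import Relation.Binary.Definitions using (DecidableEquality)
open import Relation.Binary.PropositionalEquality using (_≡_)
open import Relation.Binary.Structures using (IsDecTotalOrder)
import Relation.Binary.Construct.NonStrictToStrict as ToStrict
open import Relation.Nullary using (¬_; Dec; does; _×-dec_)

-- The axioms of the real numbers; a model is unique up to isomorphism.
record CompleteOrderedField : Set₁ where
  infix 4 _≤_
  field
    commutativeRing : CommutativeRing 0ℓ 0ℓ
  open CommutativeRing commutativeRing public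
  field
    0≉1             : ¬ 0# ≈ 1#
    inverse         : ∀ x → ¬ x ≈ 0# → ∃ λ y → x * y ≈ 1#
    _≤_             : Carrier → Carrier → Set
    isDecTotalOrder : IsDecTotalOrder _≈_ _≤_
    +-monoˡ-≤       : ∀ z {x y} → x ≤ y → x + z ≤ y + z
    *-nonneg        : ∀ {x y} → 0# ≤ x → 0# ≤ y → 0# ≤ x * y

  UpperBound : (Carrier → Set) → Carrier → Set
  UpperBound P b = ∀ x → P x → x ≤ b

  field
    supremum : ∀ P → ∃ P → ∃ (UpperBound P) →
               ∃ λ s → UpperBound P s × (∀ b → UpperBound P b → s ≤ b)

  module DTO = IsDecTotalOrder isDecTotalOrder
  open ToStrict _≈_ _≤_ public using (_<_)

  _<?_ : ∀ x y → Dec (x < y)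
  _<?_ = ToStrict.<-decidable _≈_ _≤_ DTO._≟_ DTO._≤?_

  open import Algebra.Properties.CommutativeMonoid.Sum +-commutativeMonoid public
    using (sum)
  open import Algebra.Properties.Monoid.Mult +-monoid public
    using () renaming (_×_ to _·_)

data Mode : Set where
  almost-sure positive : Mode

module POMDPs (ℝ : CompleteOrderedField) where

  open CompleteOrderedField ℝ

  record Dist (n : ℕ) : Set where
    field
      pr     : Fin n → Carrier
      nonneg : ∀ i → 0# ≤ pr i
      total  : sum pr ≈ 1#

    Supp : Fin n → Set
    Supp i = 0# < pr i

    Supp? : ∀ i → Dec (Supp i)
    Supp? i = 0# <? pr i

  open Dist public

  ----------------------------------------------------------------------
  -- A Markov chain with transition probabilities P, started at x₀.

  module MarkovChain {X : Set} (P : X → X → Carrier) (x₀ : X) where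

    Path : Set
    Path = ℕ → X

    Event : Set₁
    Event = Path → Set

    weightFrom : X → List X → Carrier
    weightFrom x []      = 1#
    weightFrom x (y ∷ w) = P x y * weightFrom y w

    -- The word w stands for the cylinder of the paths x₀ w …
    _∈Cyl_ : Path → List X → Set
    ω ∈Cyl w = applyUpTo (ω ∘ suc) (length w) ≡ w

    -- A sequence of basic sets: cylinders (just w) or the empty set (nothing).
    Sequence : Set
    Sequence = ℕ → Maybe (List X)

    _Covers_ : Sequence → Event → Set
    c Covers φ = ∀ ω → ω 0 ≡ x₀ → φ ω → ∃ λ i → ∃ λ w → c i ≡ just w × ω ∈Cyl w

    weight : Maybe (List X) → Carrier
    weight = maybe′ (weightFrom x₀) 0#

    partialSum : Sequence → ℕ → Carrier
    partialSum c n = sum {n} (λ i → weight (c (toℕ i)))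

    -- r ≤ Σᵢ weight (c i), where the sum of the series may be infinite.
    _≤Σ_ : Carrier → Sequence → Set
    r ≤Σ c = ∀ ε → 0# < ε → ∃ λ n → r ≤ partialSum c n + ε

    LowerBound : Event → Carrier → Set
    LowerBound φ r = ∀ c → c Covers φ → r ≤Σ c

    -- Carathéodory's extension of the cylinder weights: the measure of a
    -- measurable event is the infimum of the total weights of its countable
    -- covers by cylinders.
    Pr[_]≈_ : Event → Carrier → Set
    Pr[ φ ]≈ r = LowerBound φ r × (∀ q → LowerBound φ q → q ≤ r)

  ----------------------------------------------------------------------

  record POMDP : Set where
    field
      |S| |A| |O| : ℕ
      δ           : Fin |S| → Fin |A| → Dist |S|
      γ           : Fin |S| → Fin |O|
      s₀          : Fin |S|
      γ-initial   : ∀ s → γ s ≡ γ s₀ → s ≡ s₀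

  record PriorityFunction (G : POMDP) : Set where
    open POMDP G
    field
      D        : List ℕ
      D-unique : Unique D
      p        : Fin |S| → ℕ
      p∈D      : ∀ s → p s List.∈ D

    d : ℕ
    d = length D

  module _ (G : POMDP) where
    open POMDP G

    Inf : (ℕ → Fin |S|) → Fin |S| → Set
    Inf ρ s = ∀ n → ∃ λ m → n ≤ℕ m × ρ m ≡ s

    -- The objective depends on a play only through its sequence of states.
    Parity : PriorityFunction G → (ℕ → Fin |S|) → Set
    Parity π ρ = ∃ λ k → 2 ∣ k
                       × (∃ λ s → Inf ρ s × p s ≡ k)
                       × (∀ s → Inf ρ s → k ≤ℕ p s)
      where open PriorityFunction π

    -- What finite-memory and belief-based stationary strategies have in common;
    -- update m o a m′ is the probability that the next memory state is m′.
    record Controller : Set₁ where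
      field
        Memory : Set
        m₀     : Memory
        select : Memory → Dist |A|
        update : Memory → Fin |O| → Fin |A| → Memory → Carrier

      δσ : Fin |S| × Memory → Fin |S| × Memory → Carrier
      δσ (s , m) (s′ , m′) =
        sum λ a → pr (select m) a * pr (δ s a) s′ * update m (γ s′) a m′

      open MarkovChain δσ (s₀ , m₀) public

    record FMStrategy : Set where
      field
        |M| : ℕ
        m₀  : Fin |M|
        σn  : Fin |M| → Dist |A|
        σu  : Fin |M| → Fin |O| → Fin |A| → Dist |M|

      controller : Controller
      controller = record
        { Memory = Fin |M|
        ; m₀     = m₀
        ; select = σn
        ; update = λ m o a → pr (σu m o a)
        }

    Belief : Set
    Belief = Subset |S|

    _≟ᴮ_ : DecidableEquality Belief
    _≟ᴮ_ = Vec.≡-dec Bool._≟_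

    initialBelief : Belief
    initialBelief = ⁅ s₀ ⁆

    updateBelief : Belief → Fin |O| → Fin |A| → Belief
    updateBelief Y o a = tabulate λ s′ → does
      ((γ s′ ≟ᶠ o) ×-dec any? (λ s → (s ∈? Y) ×-dec Supp? (δ s a) s′))

    BeliefStrategy : Set
    BeliefStrategy = Belief → Dist |A|

    beliefController : BeliefStrategy → Controller
    beliefController b = record
      { Memory = Belief
      ; m₀     = initialBelief
      ; select = b
      ; update = λ Y o a Y′ → if does (Y′ ≟ᴮ updateBelief Y o a) then 1# else 0#
      }

    WinningController : Mode → PriorityFunction G → Controller → Set
    WinningController almost-sure π σ = Pr[ (λ ω → Parity π (proj₁ ∘ ω)) ]≈ 1#
      where open Controller σ
    WinningController positive    π σ =
      ∃ λ r → (Pr[ (λ ω → Parity π (proj₁ ∘ ω)) ]≈ r) × 0# < r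
      where open Controller σ

    Winning : Mode → PriorityFunction G → FMStrategy → Set
    Winning mode π σ = WinningController mode π (FMStrategy.controller σ)

    BeliefWinning : Mode → PriorityFunction G → BeliefStrategy → Set
    BeliefWinning mode π b = WinningController mode π (beliefController b)

    -- The components have at most N elements, and priorities as well as the
    -- numerators and denominators of the (rational) transition probabilities
    -- have binary encodings of length O(N).
    record SizeAtMost (N : ℕ) (π : PriorityFunction G) : Set where
      open PriorityFunction π
      field
        states        : |S| ≤ℕ N
        actions       : |A| ≤ℕ N
        observations  : |O| ≤ℕ N
        priorityCount : d ≤ℕ N
        priorities    : ∀ s → p s ≤ℕ 2 ^ N
        probabilities : ∀ s a s′ → ∃ λ u → ∃ λ v →
          1 ≤ℕ v × u ≤ℕ 2 ^ N × v ≤ℕ 2 ^ N × v · pr (δ s a) s′ ≈ u · 1#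

  PolynomialSize : (G : ℕ → POMDP) → (∀ n → PriorityFunction (G n)) → Set
  PolynomialSize G π = ∃ λ C → ∃ λ k → ∀ n → 1 ≤ℕ n →
    SizeAtMost (G n) (C *ℕ n ^ k) (π n)

-- f n = Ω(n)
AtLeastLinear : (ℕ → ℕ) → Set
AtLeastLinear f = ∃ λ c → ∃ λ n₀ → ∀ n → n₀ ≤ℕ n → n ≤ℕ c *ℕ f n

{-# OPTIONS --safe #-}
-- Almost every path of a finite Markov chain takes all edges leaving a state that
-- it visits infinitely often. Call a state x good for an even k if the priorities
-- reachable from x are at least k and k can be reached from whatever is reachable
-- from x. Then the parity condition has positive probability iff a good state is
-- reachable, and probability 1 iff a good state remains reachable forever. Both
-- depend only on the edges of the chain, so memory states m that agree, for all s,
-- on which k ∈ D make (s , m) good and on whether (s , m) is almost surely winning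
-- can be merged; this leaves 2 ^ (|S| * (1 + d)) of them.
--
-- Outer measures are bounded above by supermartingales (Ville's inequality) and
-- below by walking into a successor that does not increase the capital of such a
-- supermartingale plus the weight of the rest of a given cover.
module Submission where

open import Defs
open import Axiom.ExcludedMiddle using (ExcludedMiddle)
open import Data.Bool using (Bool; true; false; if_then_else_)
open import Data.Empty using (⊥-elim; ⊥)
open import Data.Fin using (Fin; zero; suc; _↑ˡ_; _↑ʳ_; combine; toℕ; remQuot; funToFin;
  finToFun; fromℕ<)
open import Data.Fin.Patterns using (0F; 1F; 2F; 3F)
open import Data.Fin.Properties using (suc-injective; remQuot-combine; combine-remQuot;
  finToFun-funToFin; any?; funToFin-finToFin; injective⇒≤; toℕ-fromℕ<; toℕ-injective; toℕ<n)
  renaming (_≟_ to _≟ᶠ_)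
open import Data.Fin.Subset using (Subset; inside; outside) renaming (_∈_ to _∈ˢ_)
open import Data.Fin.Subset.Properties using (_∈?_; x∈⁅x⁆)
open import Data.List using (List; []; _∷_; _++_; length; applyUpTo; concat; tabulate; map;
  lookup)
open import Data.List.Membership.Propositional using (_∈_)
open import Data.List.Membership.Propositional.Properties using (∈-map⁺; ∈-concat⁺′;
  ∈-tabulate⁺)
open import Data.List.Properties using (∷-injective; length-applyUpTo)
open import Data.List.Relation.Unary.All using ([]; _∷_)
open import Data.List.Relation.Unary.AllPairs using ([]; _∷_)
open import Data.List.Relation.Unary.Any using (here; there; index)
open import Data.List.Relation.Unary.Any.Properties using (lookup-index)
open import Data.Maybe using (Maybe; just; nothing)
open import Data.Nat using (ℕ; zero; suc; z≤n; s≤s; _⊔_; _∸_; _^_) renaming (_+_ to _+ℕ_; _*_ to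
  _*ℕ_; _≤_ to _≤ℕ_)
open import Data.Nat.Divisibility using (_∣_; divides; ∣1⇒≡1)
import Data.Nat.Properties as ℕ
open import Data.Nat.Solver using (module +-*-Solver)
open import Data.Product using (∃; _×_; _,_; proj₁; proj₂)
open import Data.Product.Properties using (,-injective)
open import Data.Sum using (_⊎_; inj₁; inj₂; [_,_]′)
open import Data.Unit using (⊤; tt)
open import Data.Vec using ([]; _∷_)
import Data.Vec as Vec
open import Data.Vec.Properties using (tabulate-cong; tabulate∘lookup; lookup∘tabulate;
  []=⇒lookup; lookup⇒[]=)
open import Function using (_∘_)
open import Level using (0ℓ)
open import Relation.Binary.Bundles using (Poset)
open import Relation.Binary.Construct.Closure.ReflexiveTransitive using (Star; _◅_; _◅◅_; gmap)
  renaming (ε to done)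
open import Relation.Binary.PropositionalEquality as ≡ using (_≡_; _≢_)
open import Relation.Nullary using (¬_; Dec; yes; no; does; _×-dec_)
open import Relation.Nullary.Decidable using (decidable-stable)

-- `Pr` is defined by covers of arbitrary events, and bets give access to it from both sides: a bet
-- on an event bounds its lower bounds from above, and a bet on its complement yields a lower bound
-- (`Outer-dual`). Unfair paths and impossible edges can therefore be discarded once a bet of
-- arbitrarily small capital beats them, and bets against finitely many events are simply added.
--
-- The obstacle in merging memory is that an edge of the merged chain comes from some member of the
-- class, not necessarily from the member at which the preceding edges arrived. A path of the merged
-- chain lifts only to a sequence of edges joined by jumps inside classes. A property survives such
-- a lift if it is constant on classes and closed under reachability. Being able to reach a good
-- state is not closed under reachability; goodness for a fixed `k` and almost-sure winning are, and
-- this dictates what a class has to record.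
--
-- In the two examples for the lower bounds only edges are prescribed, and probabilities are uniform
-- on the successors.

-- Ordered-field arithmetic and finite sums

module Reals (ℝ : CompleteOrderedField) where

  open CompleteOrderedField ℝ public
    renaming (refl to ≈-refl; sym to ≈-sym; trans to ≈-trans; reflexive to ≈-reflexive)
    hiding (zero)
  open DTO public using (antisym; total)
    renaming (refl to ≤-refl; trans to ≤-trans; reflexive to ≤-reflexive)

  open import Algebra.Properties.Semiring.Sum semiring public
    using (*-distribˡ-sum; *-distribʳ-sum; sum-cong-≋; sum-replicate-zero)
  open import Algebra.Properties.CommutativeMonoid.Sum +-commutativeMonoid public
    using (∑-distrib-+; ∑-comm; sum-cong-≗)
  open import Algebra.Properties.Ring ring using (-‿distribʳ-*)
  open import Algebra.Properties.CommutativeSemigroup +-commutativeSemigroup using (interchange)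
  open import Relation.Binary.Construct.NonStrictToStrict _≈_ _≤_ as Strict using ()

  ≤-poset : Poset 0ℓ 0ℓ 0ℓ
  ≤-poset = record { isPartialOrder = DTO.isPartialOrder }

  module ≤-Reasoning where
    open import Relation.Binary.Reasoning.PartialOrder ≤-poset public

  open ≤-Reasoning

  abstract
    <⇒≤ : ∀ {x y} → x < y → x ≤ y
    <⇒≤ = Strict.<⇒≤

    <⇒≱ : ∀ {x y} → x < y → ¬ y ≤ x
    <⇒≱ = Strict.<⇒≱ antisym

    ≰⇒> : ∀ {x y} → ¬ x ≤ y → y < x
    ≰⇒> = Strict.≰⇒> ≈-sym ≤-reflexive total

    ≮⇒≥ : ∀ {x y} → ¬ x < y → y ≤ x
    ≮⇒≥ = Strict.≮⇒≥ ≈-sym DTO._≟_ ≤-reflexive total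

    <-≤-trans : ∀ {x y z} → x < y → y ≤ z → x < z
    <-≤-trans {x} {y} {z} x<y y≤z = begin-strict x <⟨ x<y ⟩ y ≤⟨ y≤z ⟩ z ∎

    +-monoʳ-≤ : ∀ z {x y} → x ≤ y → z + x ≤ z + y
    +-monoʳ-≤ z {x} {y} x≤y = begin
      z + x ≈⟨ +-comm z x ⟩
      x + z ≤⟨ +-monoˡ-≤ z x≤y ⟩
      y + z ≈⟨ +-comm y z ⟩
      z + y ∎

    +-mono-≤ : ∀ {x y u v} → x ≤ y → u ≤ v → x + u ≤ y + v
    +-mono-≤ x≤y u≤v = ≤-trans (+-monoˡ-≤ _ x≤y) (+-monoʳ-≤ _ u≤v)

    +-cancelʳ-≤ : ∀ z {x y} → x + z ≤ y + z → x ≤ y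
    +-cancelʳ-≤ z {x} {y} p = begin
      x             ≈⟨ lem x ⟨
      (x + z) + - z ≤⟨ +-monoˡ-≤ (- z) p ⟩
      (y + z) + - z ≈⟨ lem y ⟩
      y             ∎
      where
      lem : ∀ x → (x + z) + - z ≈ x
      lem x = begin-equality
        (x + z) + - z ≈⟨ +-assoc x z (- z) ⟩
        x + (z + - z) ≈⟨ +-congˡ (-‿inverseʳ z) ⟩
        x + 0#        ≈⟨ +-identityʳ x ⟩
        x             ∎

    +-cancelˡ-≤ : ∀ z {x y} → z + x ≤ z + y → x ≤ y
    +-cancelˡ-≤ z {x} {y} p = +-cancelʳ-≤ z (begin
      x + z ≈⟨ +-comm x z ⟩
      z + x ≤⟨ p ⟩
      z + y ≈⟨ +-comm z y ⟩
      y + z ∎)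

    x≤x+y : ∀ {x y} → 0# ≤ y → x ≤ x + y
    x≤x+y {x} {y} 0≤y = begin
      x      ≈⟨ +-identityʳ x ⟨
      x + 0# ≤⟨ +-monoʳ-≤ x 0≤y ⟩
      x + y  ∎

    y≤x+y : ∀ {x y} → 0# ≤ x → y ≤ x + y
    y≤x+y {x} {y} 0≤x = ≤-trans (x≤x+y 0≤x) (≤-reflexive (+-comm y x))

    x<x+y : ∀ {x y} → 0# < y → x < x + y
    x<x+y {x} {y} 0<y = ≰⇒> λ p → <⇒≱ 0<y (+-cancelˡ-≤ x (≤-trans p (≤-reflexive (≈-sym (+-identityʳ x)))))

    +-nonneg : ∀ {x y} → 0# ≤ x → 0# ≤ y → 0# ≤ x + y
    +-nonneg 0≤x 0≤y = ≤-trans 0≤x (x≤x+y 0≤y)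

    +-pos : ∀ {x y} → 0# < x → 0# < y → 0# < x + y
    +-pos 0<x 0<y = <-≤-trans 0<x (x≤x+y (<⇒≤ 0<y))

    ≤⇒0≤∸ : ∀ {x y} → x ≤ y → 0# ≤ y + - x
    ≤⇒0≤∸ {x} {y} x≤y = begin
      0#      ≈⟨ -‿inverseʳ x ⟨
      x + - x ≤⟨ +-monoˡ-≤ (- x) x≤y ⟩
      y + - x ∎

    ∸+ : ∀ x y → (y + - x) + x ≈ y
    ∸+ x y = begin-equality
      (y + - x) + x ≈⟨ +-assoc y (- x) x ⟩
      y + (- x + x) ≈⟨ +-congˡ (-‿inverseˡ x) ⟩
      y + 0#        ≈⟨ +-identityʳ y ⟩
      y             ∎

    <⇒0<∸ : ∀ {x y} → x < y → 0# < y + - x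
    <⇒0<∸ {x} {y} x<y = ≰⇒> λ y-x≤0 → <⇒≱ x<y (begin
      y             ≈⟨ ∸+ x y ⟨
      (y + - x) + x ≤⟨ +-monoˡ-≤ x y-x≤0 ⟩
      0# + x        ≈⟨ +-identityˡ x ⟩
      x             ∎)

    *-monoʳ-≤ : ∀ z → 0# ≤ z → ∀ {x y} → x ≤ y → z * x ≤ z * y
    *-monoʳ-≤ z 0≤z {x} {y} x≤y = begin
      z * x                    ≈⟨ +-identityˡ _ ⟨
      0# + z * x               ≤⟨ +-monoˡ-≤ _ (*-nonneg 0≤z (≤⇒0≤∸ x≤y)) ⟩
      z * (y + - x) + z * x    ≈⟨ distribˡ z _ _ ⟨
      z * ((y + - x) + x)      ≈⟨ *-congˡ (∸+ x y) ⟩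
      z * y                    ∎

    *-monoˡ-≤ : ∀ z → 0# ≤ z → ∀ {x y} → x ≤ y → x * z ≤ y * z
    *-monoˡ-≤ z 0≤z {x} {y} x≤y = begin
      x * z ≈⟨ *-comm x z ⟩
      z * x ≤⟨ *-monoʳ-≤ z 0≤z x≤y ⟩
      z * y ≈⟨ *-comm z y ⟩
      y * z ∎

    0≤1 : 0# ≤ 1#
    0≤1 = [ (λ p → p) , (λ p → begin
        0#            ≤⟨ *-nonneg (neg p) (neg p) ⟩
        - 1# * - 1#   ≈⟨ -‿distribʳ-* (- 1#) 1# ⟨
        - (- 1# * 1#) ≈⟨ -‿cong (*-identityʳ _) ⟩
        - - 1#        ≈⟨ -‿involutive 1# ⟩
        1#            ∎) ]′ (total 0# 1#)
      where
      open import Algebra.Properties.Ring ring using () renaming (-‿involutive to -‿involutive)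
      neg : 1# ≤ 0# → 0# ≤ - 1#
      neg p = ≤-trans (≤⇒0≤∸ p) (≤-reflexive (+-identityˡ _))

    0<1 : 0# < 1#
    0<1 = 0≤1 , 0≉1

    x*y≈0⇒y≈0 : ∀ {x y} → ¬ x ≈ 0# → x * y ≈ 0# → y ≈ 0#
    x*y≈0⇒y≈0 {x} {y} x≉0 xy≈0 with x⁻¹ , x*x⁻¹≈1 ← inverse x x≉0 = begin-equality
      y             ≈⟨ *-identityˡ y ⟨
      1# * y        ≈⟨ *-congʳ x*x⁻¹≈1 ⟨
      (x * x⁻¹) * y ≈⟨ ≈-trans (*-congʳ (*-comm x x⁻¹)) (*-assoc x⁻¹ x y) ⟩
      x⁻¹ * (x * y) ≈⟨ *-congˡ xy≈0 ⟩
      x⁻¹ * 0#      ≈⟨ zeroʳ x⁻¹ ⟩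
      0#            ∎

    *-pos : ∀ {x y} → 0# < x → 0# < y → 0# < x * y
    *-pos (0≤x , 0≉x) (0≤y , 0≉y) =
      *-nonneg 0≤x 0≤y , λ 0≈xy → 0≉y (≈-sym (x*y≈0⇒y≈0 (0≉x ∘ ≈-sym) (≈-sym 0≈xy)))

    *-posˡ : ∀ {x y} → 0# ≤ x → 0# < x * y → 0# < x
    *-posˡ {x} {y} 0≤x (_ , 0≉xy) = 0≤x , λ 0≈x → 0≉xy (≈-sym (begin-equality
      x * y  ≈⟨ *-congʳ 0≈x ⟨
      0# * y ≈⟨ zeroˡ y ⟩
      0#     ∎))

    *-posʳ : ∀ {x y} → 0# ≤ y → 0# < x * y → 0# < y
    *-posʳ {x} {y} 0≤y (0≤xy , 0≉xy) = *-posˡ 0≤y (≤-trans 0≤xy (≤-reflexive (*-comm x y)) , λ e → 0≉xy (≈-trans e (*-comm y x)))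

    inverse-pos : ∀ {x} → 0# < x → ∃ λ y → 0# < y × x * y ≈ 1#
    inverse-pos {x} 0<x@(0≤x , 0≉x) with y , xy≈1 ← inverse x (0≉x ∘ ≈-sym) = y , 0<y , xy≈1
      where
      0<y : 0# < y
      0<y = ≰⇒> λ y≤0 → <⇒≱ 0<1 (begin
        1#     ≈⟨ xy≈1 ⟨
        x * y  ≤⟨ *-monoʳ-≤ x 0≤x y≤0 ⟩
        x * 0# ≈⟨ zeroʳ x ⟩
        0#     ∎)

    ½ : Carrier
    ½ = proj₁ (inverse-pos (+-pos 0<1 0<1))

    0<½ : 0# < ½
    0<½ = proj₁ (proj₂ (inverse-pos (+-pos 0<1 0<1)))

    ½*x+½*x : ∀ x → ½ * x + ½ * x ≈ x
    ½*x+½*x x = begin-equality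
      ½ * x + ½ * x       ≈⟨ distribʳ x ½ ½ ⟨
      (½ + ½) * x         ≈⟨ *-congʳ (+-cong (*-identityˡ ½) (*-identityˡ ½)) ⟨
      (1# * ½ + 1# * ½) * x ≈⟨ *-congʳ (distribʳ ½ 1# 1#) ⟨
      ((1# + 1#) * ½) * x ≈⟨ *-congʳ (proj₂ (proj₂ (inverse-pos (+-pos 0<1 0<1)))) ⟩
      1# * x              ≈⟨ *-identityˡ x ⟩
      x                   ∎

    *-factor : ∀ q a p → q * (a + p * a) ≈ (q + p * q) * a
    *-factor q a p = begin-equality
      q * (a + p * a)     ≈⟨ distribˡ q a (p * a) ⟩
      q * a + q * (p * a) ≈⟨ +-congˡ (*-assoc q p a) ⟨
      q * a + (q * p) * a ≈⟨ distribʳ a q (q * p) ⟨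
      (q + q * p) * a     ≈⟨ *-congʳ (+-congˡ (*-comm q p)) ⟩
      (q + p * q) * a     ∎

    *-½+½ : ∀ x y z → x * (½ * y + ½ * y) ≈ x * y + 0# * z
    *-½+½ x y z = begin-equality
      x * (½ * y + ½ * y) ≈⟨ *-congˡ (½*x+½*x y) ⟩
      x * y               ≈⟨ +-identityʳ _ ⟨
      x * y + 0#          ≈⟨ +-congˡ (zeroˡ z) ⟨
      x * y + 0# * z      ∎

    +-interchange : ∀ s e t f → (s + e) + (t + f) ≈ (s + t) + (e + f)
    +-interchange = interchange

    ≤+ε⇒≤ : ∀ {x y} → (∀ ε → 0# < ε → x ≤ y + ε) → x ≤ y
    ≤+ε⇒≤ {x} {y} h with DTO._≤?_ x y
    ... | yes x≤y = x≤y
    ... | no x≰y = ⊥-elim (<⇒≱ lt (h ε (*-pos 0<½ 0<d)))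
      where
      d ε : Carrier
      d = x + - y
      ε = ½ * d
      0<d : 0# < d
      0<d = ≰⇒> λ d≤0 → x≰y (begin
        x      ≈⟨ ∸+ y x ⟨
        d + y  ≤⟨ +-monoˡ-≤ y d≤0 ⟩
        0# + y ≈⟨ +-identityˡ y ⟩
        y      ∎)
      lt : y + ε < x
      lt = begin-strict
        y + ε       <⟨ x<x+y (*-pos 0<½ 0<d) ⟩
        (y + ε) + ε ≈⟨ +-assoc y ε ε ⟩
        y + (ε + ε) ≈⟨ +-congˡ (½*x+½*x d) ⟩
        y + d       ≈⟨ +-comm y d ⟩
        d + y       ≈⟨ ∸+ y x ⟩
        x           ∎

    sum-mono : ∀ {n} {f g : Fin n → Carrier} → (∀ i → f i ≤ g i) → sum f ≤ sum g
    sum-mono {zero}  _ = ≤-refl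
    sum-mono {suc n} h = +-mono-≤ (h zero) (sum-mono (h ∘ suc))

    sum-cong : ∀ {n} {f g : Fin n → Carrier} → (∀ i → f i ≈ g i) → sum f ≈ sum g
    sum-cong = sum-cong-≋

    sum-zero : ∀ {n} {f : Fin n → Carrier} → (∀ i → f i ≈ 0#) → sum f ≈ 0#
    sum-zero {n} h = ≈-trans (sum-cong h) (sum-replicate-zero n)

    sum-nonneg : ∀ {n} {f : Fin n → Carrier} → (∀ i → 0# ≤ f i) → 0# ≤ sum f
    sum-nonneg {n} h = ≤-trans (≤-reflexive (≈-sym (sum-replicate-zero n))) (sum-mono h)

    term≤sum : ∀ {n} {f : Fin n → Carrier} → (∀ i → 0# ≤ f i) → ∀ i → f i ≤ sum f
    term≤sum h zero    = x≤x+y (sum-nonneg (h ∘ suc))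
    term≤sum h (suc i) = ≤-trans (term≤sum (h ∘ suc) i) (y≤x+y (h zero))

    sum-pos⇒ : ∀ {n} {f : Fin n → Carrier} → 0# < sum f → ∃ λ i → 0# < f i
    sum-pos⇒ {zero} p = ⊥-elim (<⇒≱ p ≤-refl)
    sum-pos⇒ {suc n} {f} p with 0# <? f zero
    ... | yes q = zero , q
    ... | no ¬q with i , q ← sum-pos⇒ {n} {f ∘ suc} (<-≤-trans p (≤-trans (+-monoˡ-≤ _ (≮⇒≥ ¬q)) (≤-reflexive (+-identityˡ _))))
      = suc i , q

    sum-single : ∀ {n} {f : Fin n → Carrier} i → (∀ j → j ≢ i → f j ≈ 0#) → sum f ≈ f i
    sum-single {suc n} {f} zero    h = ≈-trans (+-congˡ (sum-zero λ j → h (suc j) λ ())) (+-identityʳ _)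
    sum-single {suc n} {f} (suc i) h = begin-equality
      f zero + sum (f ∘ suc) ≈⟨ +-cong (h zero λ ()) (sum-single i λ j j≢i → h (suc j) (j≢i ∘ suc-injective)) ⟩
      0# + f (suc i)         ≈⟨ +-identityˡ _ ⟩
      f (suc i)              ∎

    sum-↑ : ∀ m {n} (f : Fin (m +ℕ n) → Carrier) →
            sum f ≈ sum (λ i → f (i ↑ˡ n)) + sum (λ j → f (m ↑ʳ j))
    sum-↑ zero    f = ≈-sym (+-identityˡ _)
    sum-↑ (suc m) f = ≈-trans (+-congˡ (sum-↑ m (f ∘ suc))) (≈-sym (+-assoc _ _ _))

    sum-combine : ∀ m {n} (f : Fin (m *ℕ n) → Carrier) →
                  sum f ≈ sum {m} (λ i → sum {n} (λ j → f (combine i j)))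
    sum-combine zero f = ≈-refl
    sum-combine (suc m) {n} f = ≈-trans (sum-↑ n f) (+-congˡ (sum-combine m (λ k → f (n ↑ʳ k))))

-- Betting strategies and null events of a finite chain

module Bets (em : ExcludedMiddle 0ℓ) (ℝ : CompleteOrderedField) where

  open Reals ℝ
  open POMDPs ℝ
  open ≤-Reasoning

  ¬¬-elim : {A : Set} → ¬ ¬ A → A
  ¬¬-elim {A} ¬¬a with em {A}
  ... | yes a = a
  ... | no ¬a = ⊥-elim (¬¬a ¬a)

  ¬∀⇒∃¬ : {A : Set} {Q : A → Set} → ¬ (∀ a → Q a) → ∃ λ a → ¬ Q a
  ¬∀⇒∃¬ ¬∀ = ¬¬-elim λ ¬∃ → ¬∀ λ a → ¬¬-elim λ ¬q → ¬∃ (a , ¬q)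

  -- The maximum of finitely many witnesses. It supplies one time after all last visits, and one
  -- truncation of a series that serves all successors.
  common-bound : ∀ {n} {Q : Fin n → ℕ → Set} → (∀ i {k l} → k ≤ℕ l → Q i k → Q i l) →
                 (∀ i → ∃ (Q i)) → ∃ λ k → ∀ i → Q i k
  common-bound {zero} up h = 0 , λ ()
  common-bound {suc n} up h with k , q ← h zero | l , qs ← common-bound (up ∘ suc) (h ∘ suc) =
    k ⊔ l , λ { zero → up zero (ℕ.m≤m⊔n k l) q ; (suc i) → up (suc i) (ℕ.m≤n⊔m k l) (qs i) }

  Σ< : ℕ → (ℕ → Carrier) → Carrier
  Σ< n f = sum {n} (f ∘ toℕ)

  Σ<-mono : ∀ {m n f} → (∀ i → 0# ≤ f i) → m ≤ℕ n → Σ< m f ≤ Σ< n f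
  Σ<-mono {n = n} h z≤n = sum-nonneg {n} (h ∘ toℕ)
  Σ<-mono h (s≤s m≤n) = +-monoʳ-≤ _ (Σ<-mono (h ∘ suc) m≤n)

  last≤Σ< : ∀ i {f} → (∀ j → 0# ≤ f j) → f i ≤ Σ< (suc i) f
  last≤Σ< zero    h = ≤-reflexive (≈-sym (+-identityʳ _))
  last≤Σ< (suc i) h = ≤-trans (last≤Σ< i (h ∘ suc)) (y≤x+y (h 0))

  module _ {A : Set} where

    -- The infinite concatenation l ++ B 0 ++ B 1 ++ …, with nothing marking the
    -- borders between the blocks.
    flatten : (ℕ → List A) → List A → ℕ → Maybe A
    flatten B []      zero    = nothing
    flatten B []      (suc i) = flatten (B ∘ suc) (B 0) i
    flatten B (a ∷ l) zero    = just a
    flatten B (a ∷ l) (suc i) = flatten B l i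

    ∈-flatten-head : ∀ B {l a} → a ∈ l → ∃ λ i → flatten B l i ≡ just a
    ∈-flatten-head B (here ≡.refl) = 0 , ≡.refl
    ∈-flatten-head B (there a∈l) with i , eq ← ∈-flatten-head B a∈l = suc i , eq

    ∈-flatten : ∀ B l k {a} → a ∈ B k → ∃ λ i → flatten B l i ≡ just a
    ∈-flatten B []      zero    a∈ with i , eq ← ∈-flatten-head (B ∘ suc) a∈ = suc i , eq
    ∈-flatten B []      (suc k) a∈ with i , eq ← ∈-flatten (B ∘ suc) (B 0) k a∈ = suc i , eq
    ∈-flatten B (_ ∷ l) k       a∈ with i , eq ← ∈-flatten B l k a∈ = suc i , eq

  module Chain
    {X : Set} (P : X → X → Carrier) (x₀ : X) {N : ℕ} (enum : Fin N → X)
    (enum-surjective : ∀ x → ∃ λ k → enum k ≡ x)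
    (enum-injective : ∀ {k l} → enum k ≡ enum l → k ≡ l)
    (P≥0 : ∀ x y → 0# ≤ P x y)
    (P-total : ∀ x → sum (λ k → P x (enum k)) ≈ 1#)
    where

    open MarkovChain P x₀

    _≟_ : (x y : X) → Dec (x ≡ y)
    x ≟ y = em

    Edge : X → X → Set
    Edge x y = 0# < P x y

    edge? : ∀ x y → Dec (Edge x y)
    edge? x y = em

    abstract
      ∑ : (X → Carrier) → Carrier
      ∑ f = sum (f ∘ enum)

      ∑-mono : ∀ {f g} → (∀ y → f y ≤ g y) → ∑ f ≤ ∑ g
      ∑-mono {f} {g} h = sum-mono {f = f ∘ enum} {g ∘ enum} (h ∘ enum)

      ∑-+ : ∀ f g → ∑ (λ y → f y + g y) ≈ ∑ f + ∑ g
      ∑-+ f g = ∑-distrib-+ (f ∘ enum) (g ∘ enum)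

      ∑-* : ∀ f c → ∑ (λ y → f y * c) ≈ ∑ f * c
      ∑-* f c = ≈-sym (*-distribʳ-sum c (f ∘ enum))

      ∑P≈1 : ∀ x → ∑ (P x) ≈ 1#
      ∑P≈1 = P-total

      ∑-enum : ∀ f → ∑ f ≈ sum (f ∘ enum)
      ∑-enum f = ≈-refl

      term≤∑ : ∀ {f} → (∀ y → 0# ≤ f y) → ∀ y → f y ≤ ∑ f
      term≤∑ {f} h y with k , ≡.refl ← enum-surjective y = term≤sum {f = f ∘ enum} (h ∘ enum) k

      ∑-single : ∀ {f} x → (∀ y → y ≢ x → f y ≈ 0#) → ∑ f ≈ f x
      ∑-single {f} x h with k , ≡.refl ← enum-surjective x =
        sum-single k λ l l≢k → h (enum l) (l≢k ∘ enum-injective)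

    ∑-cong : ∀ {f g} → (∀ y → f y ≈ g y) → ∑ f ≈ ∑ g
    ∑-cong h = antisym (∑-mono (≤-reflexive ∘ h)) (∑-mono (≤-reflexive ∘ ≈-sym ∘ h))

    ∑P* : ∀ x c → ∑ (λ y → P x y * c) ≈ c
    ∑P* x c = begin-equality
      ∑ (λ y → P x y * c) ≈⟨ ∑-* (P x) c ⟩
      ∑ (P x) * c         ≈⟨ *-congʳ (∑P≈1 x) ⟩
      1# * c              ≈⟨ *-identityˡ c ⟩
      c                   ∎

    weight≥0 : ∀ x w → 0# ≤ weightFrom x w
    weight≥0 x []      = 0≤1
    weight≥0 x (y ∷ w) = *-nonneg (P≥0 x y) (weight≥0 y w)

    P≤1 : ∀ x y → P x y ≤ 1#
    P≤1 x y = ≤-trans (term≤∑ (P≥0 x) y) (≤-reflexive (∑P≈1 x))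

    weight≤1 : ∀ x w → weightFrom x w ≤ 1#
    weight≤1 x []      = ≤-refl
    weight≤1 x (y ∷ w) = begin
      P x y * weightFrom y w ≤⟨ *-monoʳ-≤ _ (P≥0 x y) (weight≤1 y w) ⟩
      P x y * 1#             ≈⟨ *-identityʳ _ ⟩
      P x y                  ≤⟨ P≤1 x y ⟩
      1#                     ∎

    -- A betting strategy against the chain, that is, a nonnegative supermartingale
    -- cap whose dependence on the past is mediated by a state.
    record Bet : Set₁ where
      field
        State : Set
        init  : State
        cap   : X → State → Carrier
        step  : X → State → X → State
        cap≥0 : ∀ x z → 0# ≤ cap x z
        fair  : ∀ x z → ∑ (λ y → P x y * cap y (step x z y)) ≤ cap x z

      run : Path → State → ℕ → State
      run ω z zero    = z
      run ω z (suc n) = run (ω ∘ suc) (step (ω 0) z (ω 1)) n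

      run-suc : ∀ ω z n → run ω z (suc n) ≡ step (ω n) (run ω z n) (ω (suc n))
      run-suc ω z zero    = ≡.refl
      run-suc ω z (suc n) = run-suc (ω ∘ suc) _ n

      WinsFrom : Path → State → Set
      WinsFrom ω z = ∃ λ n → 1# ≤ cap (ω n) (run ω z n)

      Wins : Path → Set
      Wins ω = WinsFrom ω init

    open Bet

    -- `s` bounds the game-theoretic outer measure: initial capital arbitrarily close to `s`
    -- suffices to reach 1 on all of `φ`. Unlike a cover by cylinders, a bet is given by its local
    -- moves.
    Outer : Event → Carrier → Set₁
    Outer φ s = ∀ ε → 0# < ε → ∃ λ (B : Bet) →
      cap B x₀ (init B) ≤ s + ε × (∀ ω → ω 0 ≡ x₀ → φ ω → Wins B ω)

    Outer-⊆ : ∀ {φ ψ s} → (∀ {ω} → ω 0 ≡ x₀ → ψ ω → φ ω) → Outer φ s → Outer ψ s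
    Outer-⊆ ψ⊆φ o ε 0<ε with B , le , wins ← o ε 0<ε = B , le , λ ω ω0 → wins ω ω0 ∘ ψ⊆φ ω0

    _⊕_ : Bet → Bet → Bet
    A ⊕ B = record
      { State = State A × State B
      ; init  = init A , init B
      ; cap   = λ { x (u , v) → cap A x u + cap B x v }
      ; step  = λ { x (u , v) y → step A x u y , step B x v y }
      ; cap≥0 = λ { x (u , v) → +-nonneg (cap≥0 A x u) (cap≥0 B x v) }
      ; fair  = λ { x (u , v) → begin
          ∑ (λ y → P x y * (cap A y (step A x u y) + cap B y (step B x v y)))
            ≈⟨ ∑-cong (λ y → distribˡ (P x y) _ _) ⟩
          ∑ (λ y → P x y * cap A y (step A x u y) + P x y * cap B y (step B x v y))
            ≈⟨ ∑-+ _ _ ⟩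
          ∑ (λ y → P x y * cap A y (step A x u y)) + ∑ (λ y → P x y * cap B y (step B x v y))
            ≤⟨ +-mono-≤ (fair A x u) (fair B x v) ⟩
          cap A x u + cap B x v ∎ }
      }

    run-⊕ : ∀ A B ω u v n → run (A ⊕ B) ω (u , v) n ≡ (run A ω u n , run B ω v n)
    run-⊕ A B ω u v zero    = ≡.refl
    run-⊕ A B ω u v (suc n) = run-⊕ A B (ω ∘ suc) _ _ n

    wins-⊕ˡ : ∀ A B {ω} → Wins A ω → Wins (A ⊕ B) ω
    wins-⊕ˡ A B {ω} (n , le) = n , ≡.subst (λ z → 1# ≤ cap (A ⊕ B) (ω n) z)
      (≡.sym (run-⊕ A B ω _ _ n)) (≤-trans le (x≤x+y (cap≥0 B _ _)))

    wins-⊕ʳ : ∀ A B {ω} → Wins B ω → Wins (A ⊕ B) ω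
    wins-⊕ʳ A B {ω} (n , le) = n , ≡.subst (λ z → 1# ≤ cap (A ⊕ B) (ω n) z)
      (≡.sym (run-⊕ A B ω _ _ n)) (≤-trans le (y≤x+y (cap≥0 A _ _)))

    -- Both bets run side by side, each with half of the slack. Capital is never negative, so one of
    -- them reaching 1 carries the sum.
    Outer-∪ : ∀ {φ ψ s t} → Outer φ s → Outer ψ t → Outer (λ ω → φ ω ⊎ ψ ω) (s + t)
    Outer-∪ {s = s} {t} oφ oψ ε 0<ε
      with A , leA , winsA ← oφ (½ * ε) (*-pos 0<½ 0<ε)
         | B , leB , winsB ← oψ (½ * ε) (*-pos 0<½ 0<ε) =
      A ⊕ B , (begin
        cap A x₀ (init A) + cap B x₀ (init B) ≤⟨ +-mono-≤ leA leB ⟩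
        (s + ½ * ε) + (t + ½ * ε)
          ≈⟨ +-interchange s _ t _ ⟩
        (s + t) + (½ * ε + ½ * ε)             ≈⟨ +-congˡ (½*x+½*x ε) ⟩
        (s + t) + ε                           ∎) ,
      λ ω ω0 → [ wins-⊕ˡ A B ∘ winsA ω ω0 , wins-⊕ʳ A B ∘ winsB ω ω0 ]′

    Outer-≈ : ∀ {φ s t} → s ≈ t → Outer φ s → Outer φ t
    Outer-≈ s≈t o ε 0<ε with B , le , wins ← o ε 0<ε = B , ≤-trans le (≤-reflexive (+-congʳ s≈t)) , wins

    constant : (c : Carrier) → 0# ≤ c → Bet
    constant c 0≤c = record
      { State = X ; init = x₀ ; cap = λ _ _ → c ; step = λ _ _ y → y
      ; cap≥0 = λ _ _ → 0≤c ; fair = λ x _ → ≤-reflexive (∑P* x c) }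

    Outer-⋃ : ∀ {n} {φ : Fin n → Event} → (∀ i → Outer (φ i) 0#) → Outer (λ ω → ∃ λ i → φ i ω) 0#
    Outer-⋃ {zero} o ε 0<ε = constant 0# ≤-refl , ≤-trans (<⇒≤ 0<ε) (≤-reflexive (≈-sym (+-identityˡ ε))) , λ { _ _ (() , _) }
    Outer-⋃ {suc n} o = Outer-⊆ (λ { _ (zero , p) → inj₁ p ; _ (suc i , p) → inj₂ (i , p) })
      (Outer-≈ (+-identityˡ 0#) (Outer-∪ (o zero) (Outer-⋃ (o ∘ suc))))

    Outer-⋃ˣ : ∀ {φ : X → Event} → (∀ x → Outer (φ x) 0#) → Outer (λ ω → ∃ λ x → φ x ω) 0#
    Outer-⋃ˣ {φ} o = Outer-⊆ reindex (Outer-⋃ (o ∘ enum))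
      where
      reindex : ∀ {ω} → ω 0 ≡ x₀ → (∃ λ x → φ x ω) → ∃ λ k → φ (enum k) ω
      reindex _ (x , p) with k , ≡.refl ← enum-surjective x = k , p

    Positive : Event
    Positive ω = ∀ n → Edge (ω n) (ω (suc n))

    -- The bet stays at capital 0 until an edge of probability 0 is taken.
    Outer-¬Positive : Outer (λ ω → ¬ Positive ω) 0#
    Outer-¬Positive ε 0<ε = B , ≤-trans (<⇒≤ 0<ε) (≤-reflexive (≈-sym (+-identityˡ ε))) , wins
      where
      value : Bool → Carrier
      value b = if b then 1# else 0#

      next : X → Bool → X → Bool
      next x b y = if does (edge? x y) then b else true

      value≥0 : ∀ b → 0# ≤ value b
      value≥0 true  = 0≤1
      value≥0 false = ≤-refl

      term : ∀ x b y → P x y * value (next x b y) ≤ P x y * value b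
      term x b y with edge? x y
      ... | yes _  = ≤-refl
      ... | no ¬0<P = begin
        P x y * 1#      ≤⟨ *-monoˡ-≤ 1# 0≤1 (≮⇒≥ ¬0<P) ⟩
        0# * 1#         ≈⟨ zeroˡ 1# ⟩
        0#              ≤⟨ *-nonneg (P≥0 x y) (value≥0 b) ⟩
        P x y * value b ∎

      B : Bet
      B = record
        { State = Bool ; init = false ; cap = λ _ → value ; step = next ; cap≥0 = λ _ → value≥0
        ; fair = λ x b → ≤-trans (∑-mono (term x b)) (≤-reflexive (∑P* x (value b))) }

      wins : ∀ ω → ω 0 ≡ x₀ → ¬ Positive ω → Wins B ω
      wins ω _ ¬pos with n , ¬e ← ¬∀⇒∃¬ ¬pos =
        suc n , ≤-reflexive (≈-reflexive (≡.cong value (≡.sym (≡.trans (run-suc B ω false n) (lemma (run B ω false n))))))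
        where
        lemma : ∀ b → next (ω n) b (ω (suc n)) ≡ true
        lemma b with edge? (ω n) (ω (suc n))
        ... | yes e = ⊥-elim (¬e e)
        ... | no _  = ≡.refl

    Inf∞ : Path → X → Set
    Inf∞ ω x = ∀ n → ∃ λ m → n ≤ℕ m × ω m ≡ x

    Fin∞ : Path → X → Set
    Fin∞ ω x = ∃ λ n → ∀ m → n ≤ℕ m → ω m ≢ x

    ¬Inf⇒Fin : ∀ {ω x} → ¬ Inf∞ ω x → Fin∞ ω x
    ¬Inf⇒Fin ¬inf with n , ¬h ← ¬∀⇒∃¬ ¬inf = n , λ m n≤m ωm → ¬h (m , n≤m , ωm)

    -- Only the target of the edge has to recur, which is weaker than taking the edge infinitely
    -- often but enough to propagate recurrence along `Reach`.
    Fair : Event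
    Fair ω = ∀ x y → Edge x y → Inf∞ ω x → Inf∞ ω y

    -- At every visit of y the stake is placed on not moving to z next. A lost
    -- stake is replaced by half of the reserve, so there always remains something
    -- to be multiplied by 1 + P y z at each later visit.
    module EdgeBet (y z : X) (0<p : Edge y z) where

      p : Carrier
      p = P y z

      record Purse : Set where
        constructor purse
        field
          reserve stake : Carrier
          reserve>0     : 0# < reserve
          stake>0       : 0# < stake
      open Purse

      worth : Purse → Carrier
      worth u = reserve u + stake u

      win lose : Purse → Purse
      win  (purse r a 0<r 0<a) = purse r (a + p * a) 0<r (+-pos 0<a (*-pos 0<p 0<a))
      lose (purse r a 0<r 0<a) = purse (½ * r) (½ * r) (*-pos 0<½ 0<r) (*-pos 0<½ 0<r)

      settle : Purse → X → Purse
      settle u x′ = if does (x′ ≟ z) then lose u else win u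

      next : X → Purse → X → Purse
      next x u x′ = if does (x ≟ y) then settle u x′ else u

      worth≥0 : ∀ u → 0# ≤ worth u
      worth≥0 u = +-nonneg (<⇒≤ (reserve>0 u)) (<⇒≤ (stake>0 u))

      off on : X → Carrier
      off x′ = if does (x′ ≟ z) then 0# else P y x′
      on  x′ = if does (x′ ≟ z) then P y x′ else 0#

      p≤∑on : p ≤ ∑ on
      p≤∑on = ≤-trans (lemma z ≡.refl) (term≤∑ on≥0 z)
        where
        on≥0 : ∀ x′ → 0# ≤ on x′
        on≥0 x′ with x′ ≟ z
        ... | yes _ = P≥0 y x′
        ... | no _  = ≤-refl
        lemma : ∀ x′ → x′ ≡ z → P y x′ ≤ on x′
        lemma x′ eq with x′ ≟ z
        ... | yes _ = ≤-refl
        ... | no ¬eq = ⊥-elim (¬eq eq)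

      q : Carrier
      q = ∑ off

      q+p≤1 : q + p ≤ 1#
      q+p≤1 = begin
        q + p                   ≤⟨ +-monoʳ-≤ q p≤∑on ⟩
        q + ∑ on                ≈⟨ ∑-+ off on ⟨
        ∑ (λ x′ → off x′ + on x′) ≈⟨ ∑-cong split ⟩
        ∑ (P y)                 ≈⟨ ∑P≈1 y ⟩
        1#                      ∎
        where
        split : ∀ x′ → off x′ + on x′ ≈ P y x′
        split x′ with x′ ≟ z
        ... | yes _ = +-identityˡ _
        ... | no _  = +-identityʳ _

      -- The expected stake after a visit of `y` is `q * (1 + p)` times the old one. The factor
      -- `1 + p` stays below the exactly fair payoff `1 / (1 - p)` and makes sense also for `p = 1`.
      q+pq≤1 : q + p * q ≤ 1#
      q+pq≤1 = begin
        q + p * q  ≤⟨ +-monoʳ-≤ q (*-monoʳ-≤ p (P≥0 y z) (≤-trans (x≤x+y (P≥0 y z)) q+p≤1)) ⟩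
        q + p * 1# ≈⟨ +-congˡ (*-identityʳ p) ⟩
        q + p      ≤⟨ q+p≤1 ⟩
        1#         ∎

      term : ∀ u x′ → P y x′ * worth (settle u x′) ≤ P y x′ * reserve u + off x′ * (stake u + p * stake u)
      term u x′ with x′ ≟ z
      ... | yes _ = ≤-reflexive (*-½+½ (P y x′) (reserve u) (stake u + p * stake u))
      ... | no _  = ≤-reflexive (distribˡ (P y x′) (reserve u) (stake u + p * stake u))

      settle-fair : ∀ u → ∑ (λ x′ → P y x′ * worth (settle u x′)) ≤ worth u
      settle-fair u = begin
        ∑ (λ x′ → P y x′ * worth (settle u x′)) ≤⟨ ∑-mono (term u) ⟩
        ∑ (λ x′ → P y x′ * r + off x′ * b)
          ≈⟨ ∑-+ _ _ ⟩
        ∑ (λ x′ → P y x′ * r) + ∑ (λ x′ → off x′ * b)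
          ≈⟨ +-cong (∑P* y r) (∑-* off b) ⟩
        r + q * (a + p * a)
          ≈⟨ +-congˡ (*-factor q a p) ⟩
        r + (q + p * q) * a ≤⟨ +-monoʳ-≤ r (*-monoˡ-≤ a (<⇒≤ (stake>0 u)) q+pq≤1) ⟩
        r + 1# * a          ≈⟨ +-congˡ (*-identityˡ a) ⟩
        r + a               ∎
        where
        r a b : Carrier
        r = reserve u
        a = stake u
        b = a + p * a

      next-fair : ∀ x u → ∑ (λ x′ → P x x′ * worth (next x u x′)) ≤ worth u
      next-fair x u with x ≟ y
      ... | no _       = ≤-reflexive (∑P* x (worth u))
      ... | yes ≡.refl = settle-fair u

      bet : ∀ ε → 0# < ε → Bet
      bet ε 0<ε = record
        { State = Purse ; init = purse (½ * ε) (½ * ε) (*-pos 0<½ 0<ε) (*-pos 0<½ 0<ε)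
        ; cap = λ _ → worth ; step = next ; cap≥0 = λ _ → worth≥0 ; fair = next-fair }

      stake-mono : ∀ x u x′ → x′ ≢ z → stake u ≤ stake (next x u x′)
      stake-mono x u x′ x′≢z with x ≟ y
      ... | no _ = ≤-refl
      ... | yes _ with x′ ≟ z
      ...   | yes x′≡z = ⊥-elim (x′≢z x′≡z)
      ...   | no _     = x≤x+y (<⇒≤ (*-pos 0<p (stake>0 u)))

      stake-grows : ∀ u x x′ → x ≡ y → x′ ≢ z → stake (next x u x′) ≡ stake u + p * stake u
      stake-grows u x x′ x≡y x′≢z with x ≟ y
      ... | no x≢y = ⊥-elim (x≢y x≡y)
      ... | yes _ with x′ ≟ z
      ...   | yes x′≡z = ⊥-elim (x′≢z x′≡z)
      ...   | no _     = ≡.refl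

      -- After the last visit of `z` no stake is lost, so the stake never shrinks and each visit of
      -- `y` adds at least the fixed amount `p * s n`. If the bet never won, the stakes would be
      -- bounded by 1, yet their supremum could be lowered by that amount.
      outer : Outer (λ ω → Inf∞ ω y × Fin∞ ω z) 0#
      outer ε 0<ε = bet ε 0<ε ,
        ≤-reflexive (≈-trans (½*x+½*x ε) (≈-sym (+-identityˡ ε))) ,
        λ ω _ → λ { (infy , n , finz) → ¬¬-elim λ ¬wins → absurd ω infy n finz ¬wins }
        where
        B = bet ε 0<ε
        module _ (ω : Path) (infy : Inf∞ ω y) (n : ℕ) (finz : ∀ m → n ≤ℕ m → ω m ≢ z) (¬wins : ¬ Wins B ω) where
          s : ℕ → Carrier
          s m = stake (run B ω (init B) m)

          s-step : ∀ m → n ≤ℕ m → s m ≤ s (suc m)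
          s-step m n≤m = ≡.subst (λ v → s m ≤ stake v) (≡.sym (run-suc B ω (init B) m))
            (stake-mono (ω m) _ (ω (suc m)) (finz (suc m) (ℕ.m≤n⇒m≤1+n n≤m)))

          s-mono+ : ∀ {m} k → n ≤ℕ m → s m ≤ s (k +ℕ m)
          s-mono+ zero    n≤m = ≤-refl
          s-mono+ (suc k) n≤m = ≤-trans (s-mono+ k n≤m) (s-step _ (ℕ.≤-trans n≤m (ℕ.m≤n+m _ k)))

          s-mono : ∀ {m m′} → n ≤ℕ m → m ≤ℕ m′ → s m ≤ s m′
          s-mono {m} {m′} n≤m m≤m′ = ≡.subst (λ i → s m ≤ s i) (ℕ.m∸n+n≡m m≤m′) (s-mono+ (m′ ∸ m) n≤m)

          Stake : Carrier → Set
          Stake x = ∃ λ m → n ≤ℕ m × x ≡ s m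

          bounded : UpperBound Stake 1#
          bounded x (m , _ , ≡.refl) = ≤-trans (y≤x+y (<⇒≤ (reserve>0 (run B ω (init B) m))))
            (<⇒≤ (≰⇒> λ 1≤ → ¬wins (m , 1≤)))

          absurd : ⊥
          absurd with t , ub , least ← supremum Stake (s n , n , ℕ.≤-refl , ≡.refl) (1# , bounded) =
            <⇒≱ (x<x+y {t} (*-pos 0<p (stake>0 (run B ω (init B) n))))
              (≤-trans (+-monoˡ-≤ gain (least _ below)) (≤-reflexive (∸+ gain t)))
            where
            gain : Carrier
            gain = p * s n
            below : UpperBound Stake (t + - gain)
            below x (m , n≤m , ≡.refl) with m′ , m≤m′ , at-y ← infy m = +-cancelʳ-≤ gain (begin
              s m + gain      ≤⟨ +-mono-≤ (s-mono n≤m m≤m′) (*-monoʳ-≤ p (P≥0 y z) (s-mono ℕ.≤-refl n≤m′)) ⟩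
              s m′ + p * s m′ ≡⟨ ≡.trans (≡.cong stake (run-suc B ω (init B) m′)) (stake-grows _ (ω m′) (ω (suc m′)) at-y (finz (suc m′) (ℕ.m≤n⇒m≤1+n n≤m′))) ⟨
              s (suc m′)      ≤⟨ ub _ (suc m′ , ℕ.m≤n⇒m≤1+n n≤m′ , ≡.refl) ⟩
              t               ≈⟨ ∸+ gain t ⟨
              (t + - gain) + gain ∎)
              where n≤m′ = ℕ.≤-trans n≤m m≤m′

    Outer-¬Fair : Outer (λ ω → ¬ Fair ω) 0#
    Outer-¬Fair = Outer-⊆ unfair (Outer-⋃ˣ λ y → Outer-⋃ˣ λ z → on-edge y z)
      where
      Unfair : X → X → Event
      Unfair y z ω = Edge y z × Inf∞ ω y × Fin∞ ω z
      on-edge : ∀ y z → Outer (Unfair y z) 0#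
      on-edge y z with edge? y z
      ... | yes e = Outer-⊆ (λ _ → proj₂) (EdgeBet.outer y z e)
      -- Without an edge the event is empty, hence contained in a union over `Fin 0`.
      ... | no ¬e = Outer-⊆ {φ = λ ω → ∃ λ (i : Fin 0) → Unfair y z ω} (λ { _ (e , _) → ⊥-elim (¬e e) }) (Outer-⋃ λ ())
      unfair : ∀ {ω} → ω 0 ≡ x₀ → ¬ Fair ω → ∃ λ y → ∃ λ z → Unfair y z ω
      unfair _ ¬fair with y , ¬f ← ¬∀⇒∃¬ ¬fair with z , ¬f ← ¬∀⇒∃¬ ¬f =
        y , z , ¬¬-elim λ ¬u → ¬f λ e inf → ¬¬-elim λ ¬inf → ¬u (e , inf , ¬Inf⇒Fin ¬inf)

    -- Ville's inequality and its converse

    weightΣ : X → List (List X) → Carrier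
    weightΣ x []       = 0#
    weightΣ x (w ∷ ws) = weightFrom x w + weightΣ x ws

    weightΣ-++ : ∀ x vs ws → weightΣ x (vs ++ ws) ≈ weightΣ x vs + weightΣ x ws
    weightΣ-++ x []       ws = ≈-sym (+-identityˡ _)
    weightΣ-++ x (v ∷ vs) ws = ≈-trans (+-congˡ (weightΣ-++ x vs ws)) (≈-sym (+-assoc _ _ _))

    weightΣ-map : ∀ x y ws → weightΣ x (map (y ∷_) ws) ≈ P x y * weightΣ y ws
    weightΣ-map x y []       = ≈-sym (zeroʳ _)
    weightΣ-map x y (w ∷ ws) = ≈-trans (+-congˡ (weightΣ-map x y ws)) (≈-sym (distribˡ _ _ _))

    weightΣ-concat : ∀ x {n} (f : Fin n → List (List X)) →
                     weightΣ x (concat (tabulate f)) ≈ sum (λ i → weightΣ x (f i))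
    weightΣ-concat x {zero}  f = ≈-refl
    weightΣ-concat x {suc n} f = ≈-trans (weightΣ-++ x (f zero) _) (+-congˡ (weightΣ-concat x (f ∘ suc)))

    weightΣ≥0 : ∀ x ws → 0# ≤ weightΣ x ws
    weightΣ≥0 x []       = ≤-refl
    weightΣ≥0 x (w ∷ ws) = +-nonneg (weight≥0 x w) (weightΣ≥0 x ws)

    partialSum-flatten : ∀ n B l → partialSum (flatten B l) n ≤ weightΣ x₀ l + Σ< n (weightΣ x₀ ∘ B)
    partialSum-flatten zero B l = +-nonneg (weightΣ≥0 x₀ l) ≤-refl
    partialSum-flatten (suc n) B [] = +-monoʳ-≤ 0# (partialSum-flatten n (B ∘ suc) (B 0))
    partialSum-flatten (suc n) B (w ∷ l) = begin
      weightFrom x₀ w + partialSum (flatten B l) n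
        ≤⟨ +-monoʳ-≤ _ (partialSum-flatten n B l) ⟩
      weightFrom x₀ w + (weightΣ x₀ l + Σ< n (weightΣ x₀ ∘ B))
        ≈⟨ +-assoc _ _ _ ⟨
      weightFrom x₀ w + weightΣ x₀ l + Σ< n (weightΣ x₀ ∘ B)
        ≤⟨ +-monoʳ-≤ _ (Σ<-mono (λ i → weightΣ≥0 x₀ (B i)) (ℕ.n≤1+n n)) ⟩
      weightFrom x₀ w + weightΣ x₀ l + Σ< (suc n) (weightΣ x₀ ∘ B) ∎

    -- Ville's inequality: the words along which the capital reaches 1 for the first
    -- time cover every path on which the bet wins, and their total weight is at
    -- most the initial capital.
    module Ville (B : Bet) where

      won? : ∀ x z → Dec (1# ≤ cap B x z)
      won? x z = em

      words : X → State B → ℕ → List (List X)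
      extensions : X → State B → ℕ → Fin N → List (List X)

      words x z zero    = if does (won? x z) then [] ∷ [] else []
      words x z (suc n) = if does (won? x z) then [] else concat (tabulate (extensions x z n))

      extensions x z n k = map (enum k ∷_) (words (enum k) (step B x z (enum k)) n)

      -- Splitting off the first letter turns the total from `x` into the mean of the totals from
      -- its successors, and `fair` bounds the mean of their capitals. Where the bet has already
      -- won, only the empty word is left, of weight 1.
      wordsTotal : ∀ x z n → Σ< n (weightΣ x ∘ words x z) ≤ cap B x z
      wordsTotal x z zero = cap≥0 B x z
      wordsTotal x z (suc n) with won? x z
      ... | yes 1≤cap = begin
        (1# + 0#) + Σ< n (λ _ → 0#) ≈⟨ +-cong (+-identityʳ 1#) (sum-replicate-zero n) ⟩
        1# + 0#                     ≈⟨ +-identityʳ 1# ⟩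
        1#                          ≤⟨ 1≤cap ⟩
        cap B x z                   ∎
      ... | no _ = begin
        0# + Σ< n (λ i → weightΣ x (concat (tabulate (extensions x z i)))) ≈⟨ +-identityˡ _ ⟩
        Σ< n (λ i → weightΣ x (concat (tabulate (extensions x z i))))
          ≈⟨ sum-cong {n} (λ i → weightΣ-concat x (extensions x z (toℕ i))) ⟩
        sum {n} (λ i → sum {N} (λ k → weightΣ x (extensions x z (toℕ i) k)))
          ≈⟨ ∑-comm {n} {N} (λ i k → weightΣ x (extensions x z (toℕ i) k)) ⟩
        sum {N} (λ k → sum {n} (λ i → weightΣ x (extensions x z (toℕ i) k)))
          ≈⟨ sum-cong {N} (λ k → sum-cong {n} (λ i → weightΣ-map x (enum k) (next k (toℕ i)))) ⟩
        sum {N} (λ k → sum {n} (λ i → P x (enum k) * weightΣ (enum k) (next k (toℕ i))))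
          ≈⟨ sum-cong {N} (λ k → *-distribˡ-sum {n} (P x (enum k)) (λ i → weightΣ (enum k) (next k (toℕ i)))) ⟨
        sum {N} (λ k → P x (enum k) * Σ< n (weightΣ (enum k) ∘ next k))
          ≤⟨ sum-mono {N} (λ k → *-monoʳ-≤ _ (P≥0 x (enum k)) (wordsTotal (enum k) (step B x z (enum k)) n)) ⟩
        sum {N} (λ k → P x (enum k) * cap B (enum k) (step B x z (enum k)))
          ≈⟨ ∑-enum (λ y → P x y * cap B y (step B x z y)) ⟨
        ∑ (λ y → P x y * cap B y (step B x z y)) ≤⟨ fair B x z ⟩
        cap B x z ∎
        where
        next : Fin N → ℕ → List (List X)
        next k = words (enum k) (step B x z (enum k))

      prefix : Path → ℕ → List X
      prefix ω n = applyUpTo (ω ∘ suc) n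

      now : ∀ x z → 1# ≤ cap B x z → [] ∈ words x z 0
      now x z le with won? x z
      ... | yes _ = here ≡.refl
      ... | no ¬le = ⊥-elim (¬le le)

      later : ∀ x z y w n → ¬ 1# ≤ cap B x z → w ∈ words y (step B x z y) n → y ∷ w ∈ words x z (suc n)
      later x z y w n ¬le w∈ with won? x z
      ... | yes le = ⊥-elim (¬le le)
      ... | no _ with k , ≡.refl ← enum-surjective y =
        ∈-concat⁺′ (∈-map⁺ (y ∷_) w∈) (∈-tabulate⁺ {f = extensions x z n} k)

      -- Capital may have reached 1 before time `n`; the recursion stops at the first such moment
      -- `k`, whose prefix is the listed word.
      prefix∈words : ∀ n ω z → 1# ≤ cap B (ω n) (run B ω z n) → ∃ λ k → prefix ω k ∈ words (ω 0) z k
      prefix∈words n ω z le with won? (ω 0) z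
      prefix∈words n       ω z le | yes le₀ = 0 , now (ω 0) z le₀
      prefix∈words zero    ω z le | no ¬le₀ = ⊥-elim (¬le₀ le)
      prefix∈words (suc n) ω z le | no ¬le₀ with k , w∈ ← prefix∈words n (ω ∘ suc) _ le =
        suc k , later (ω 0) z (ω 1) (prefix (ω ∘ suc) k) k ¬le₀ w∈

      -- The blocks, one per word length, may be empty. The weightless `nothing` at each border lets
      -- an index pass through them.
      cover : Sequence
      cover = flatten (words x₀ (init B)) []

      cover-covers : cover Covers Wins B
      cover-covers ω ≡.refl (n , le) with k , w∈ ← prefix∈words n ω (init B) le
                                        with i , eq ← ∈-flatten (words x₀ (init B)) [] k w∈ =
        i , prefix ω k , eq , ≡.cong (prefix ω) (length-applyUpTo (ω ∘ suc) k)

      cover-total : ∀ n → partialSum cover n ≤ cap B x₀ (init B)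
      cover-total n = begin
        partialSum cover n ≤⟨ partialSum-flatten n (words x₀ (init B)) [] ⟩
        0# + Σ< n (weightΣ x₀ ∘ words x₀ (init B)) ≈⟨ +-identityˡ _ ⟩
        Σ< n (weightΣ x₀ ∘ words x₀ (init B)) ≤⟨ wordsTotal x₀ (init B) n ⟩
        cap B x₀ (init B) ∎

    LowerBound≤Outer : ∀ {φ r s} → Outer φ s → LowerBound φ r → r ≤ s
    LowerBound≤Outer {φ} {r} {s} o lb = ≤+ε⇒≤ λ ε 0<ε → bound ε 0<ε
      where
      bound : ∀ ε → 0# < ε → r ≤ s + ε
      bound ε 0<ε with B , le , wins ← o (½ * ε) (*-pos 0<½ 0<ε)
        with n , r≤ ← lb (Ville.cover B) (λ ω ω0 φω → Ville.cover-covers B ω ω0 (wins ω ω0 φω)) (½ * ε) (*-pos 0<½ 0<ε) = begin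
        r                                       ≤⟨ r≤ ⟩
        partialSum (Ville.cover B) n + ½ * ε    ≤⟨ +-monoˡ-≤ _ (≤-trans (Ville.cover-total B n) le) ⟩
        (s + ½ * ε) + ½ * ε                     ≈⟨ +-assoc _ _ _ ⟩
        s + (½ * ε + ½ * ε)                     ≈⟨ +-congˡ (½*x+½*x ε) ⟩
        s + ε                                   ∎

    -- A bet with capital below 1 - Σ weights leaves a path of positive edges that
    -- the cover misses and on which the bet never wins: always move to a
    -- successor that does not increase the capital plus the residual weight.
    module Greedy (B : Bet) (η : Carrier) (0<η : 0# < η) where

      -- What is left of a cylinder after a move to `y`: the empty set once a letter disagrees, and
      -- the whole space for good once all letters have been read.
      residual : X → Maybe (List X) → Maybe (List X)
      residual y nothing        = nothing
      residual y (just [])      = just []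
      residual y (just (z ∷ w)) = if does (y ≟ z) then just w else nothing

      weightAt : X → Maybe (List X) → Carrier
      weightAt x nothing  = 0#
      weightAt x (just w) = weightFrom x w

      weightAt≥0 : ∀ x m → 0# ≤ weightAt x m
      weightAt≥0 x nothing  = ≤-refl
      weightAt≥0 x (just w) = weight≥0 x w

      weightAt≡ : ∀ m → weightAt x₀ m ≡ weight m
      weightAt≡ nothing  = ≡.refl
      weightAt≡ (just w) = ≡.refl

      residual-self : ∀ y w → residual y (just (y ∷ w)) ≡ just w
      residual-self y w with y ≟ y
      ... | yes _  = ≡.refl
      ... | no ¬eq = ⊥-elim (¬eq ≡.refl)

      residual-fair : ∀ x m → ∑ (λ y → P x y * weightAt y (residual y m)) ≤ weightAt x m
      residual-fair x nothing   = ≤-reflexive (∑P* x 0#)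
      residual-fair x (just []) = ≤-reflexive (∑P* x 1#)
      residual-fair x (just (z ∷ w)) = begin
        ∑ (λ y → P x y * weightAt y (residual y (just (z ∷ w)))) ≈⟨ ∑-single z off ⟩
        P x z * weightAt z (residual z (just (z ∷ w)))           ≤⟨ *-monoʳ-≤ _ (P≥0 x z) at ⟩
        P x z * weightFrom z w                                   ∎
        where
        off : ∀ y → y ≢ z → P x y * weightAt y (residual y (just (z ∷ w))) ≈ 0#
        off y y≢z with y ≟ z
        ... | yes y≡z = ⊥-elim (y≢z y≡z)
        ... | no _    = zeroʳ _
        at : weightAt z (residual z (just (z ∷ w))) ≤ weightFrom z w
        at with z ≟ z
        ... | yes _ = ≤-refl
        ... | no ¬eq = ⊥-elim (¬eq ≡.refl)

      -- The possibly infinite weight of the cover is represented by all its truncations `n`. The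
      -- reserve `η` makes a bound of 1 on the potential a strict bound on the capital and on each
      -- single weight.
      potential : ℕ → X → State B → Sequence → Carrier
      potential n x z c = (cap B x z + Σ< n (weightAt x ∘ c)) + η

      potential-mono : ∀ {m n} x z c → m ≤ℕ n → potential m x z c ≤ potential n x z c
      potential-mono x z c m≤n = +-monoˡ-≤ η (+-monoʳ-≤ _ (Σ<-mono (λ i → weightAt≥0 x (c i)) m≤n))

      Σ<-residual : ∀ n x c → ∑ (λ y → P x y * Σ< n (weightAt y ∘ residual y ∘ c)) ≤ Σ< n (weightAt x ∘ c)
      Σ<-residual zero x c = ≤-reflexive (∑P* x 0#)
      Σ<-residual (suc n) x c = begin
        ∑ (λ y → P x y * (weightAt y (residual y (c 0)) + Σ< n (weightAt y ∘ residual y ∘ c ∘ suc)))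
          ≈⟨ ∑-cong (λ y → distribˡ (P x y) _ _) ⟩
        ∑ (λ y → P x y * weightAt y (residual y (c 0)) + P x y * Σ< n (weightAt y ∘ residual y ∘ c ∘ suc))
          ≈⟨ ∑-+ _ _ ⟩
        ∑ (λ y → P x y * weightAt y (residual y (c 0))) + ∑ (λ y → P x y * Σ< n (weightAt y ∘ residual y ∘ c ∘ suc))
          ≤⟨ +-mono-≤ (residual-fair x (c 0)) (Σ<-residual n x (c ∘ suc)) ⟩
        weightAt x (c 0) + Σ< n (weightAt x ∘ c ∘ suc) ∎

      potential-fair : ∀ n x z c →
        ∑ (λ y → P x y * potential n y (step B x z y) (residual y ∘ c)) ≤ potential n x z c
      potential-fair n x z c = begin
        ∑ (λ y → P x y * ((cap B y (step B x z y) + R y) + η))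
          ≈⟨ ∑-cong (λ y → ≈-trans (distribˡ (P x y) _ η) (+-congʳ (distribˡ (P x y) _ _))) ⟩
        ∑ (λ y → (P x y * cap B y (step B x z y) + P x y * R y) + P x y * η)
          ≈⟨ ≈-trans (∑-+ _ _) (+-cong (∑-+ _ _) (∑P* x η)) ⟩
        (∑ (λ y → P x y * cap B y (step B x z y)) + ∑ (λ y → P x y * R y)) + η
          ≤⟨ +-monoˡ-≤ η (+-mono-≤ (fair B x z) (Σ<-residual n x c)) ⟩
        potential n x z c ∎
        where
        R : X → Carrier
        R y = Σ< n (weightAt y ∘ residual y ∘ c)

      record Position : Set where
        constructor position
        field
          at        : X
          state     : State B
          remaining : Sequence
          safe      : ∀ n → potential n at state remaining ≤ 1#
      open Position

      ∃-edge : ∀ x → ∃ (Edge x)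
      ∃-edge x = ¬¬-elim λ ¬e → <⇒≱ 0<1 (begin
        1#             ≈⟨ ∑P≈1 x ⟨
        ∑ (P x)        ≤⟨ ∑-mono (λ y → ≮⇒≥ λ e → ¬e (y , e)) ⟩
        ∑ (λ y → 0#)   ≈⟨ ∑-cong (λ y → zeroʳ (P x y)) ⟨
        ∑ (λ y → P x y * 0#) ≈⟨ ∑P* x 0# ⟩
        0#             ∎)

      Safe-move : Position → X → Set
      Safe-move u y = Edge (at u) y ×
        (∀ n → potential n y (step B (at u) (state u) y) (residual y ∘ remaining u) ≤ 1#)

      -- If every edge breaks safety, each at its own truncation, then by monotonicity all edges do
      -- so at a common `m`. The mean of the potentials at `m` then exceeds 1, although
      -- `potential-fair` bounds it by the potential at `u`.
      module Stuck (u : Position) (¬move : ¬ ∃ (Safe-move u)) where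

        open Position u renaming (at to x; state to z; remaining to c; safe to safe-at)

        V : ℕ → X → Carrier
        V n y = potential n y (step B x z y) (residual y ∘ c)

        exceeded : ∀ k → ∃ λ n → Edge x (enum k) → 1# < V n (enum k)
        exceeded k with em {Edge x (enum k)}
        ... | no ¬e = 0 , λ e → ⊥-elim (¬e e)
        ... | yes e with n , ¬≤ ← ¬∀⇒∃¬ (λ all → ¬move (enum k , e , all)) = n , λ _ → ≰⇒> ¬≤

        all-exceeded : ∃ λ n → ∀ k → Edge x (enum k) → 1# < V n (enum k)
        all-exceeded = common-bound
          (λ k m≤n h e → <-≤-trans (h e) (potential-mono (enum k) (step B x z (enum k)) (residual (enum k) ∘ c) m≤n)) exceeded

        m : ℕ
        m = proj₁ all-exceeded

        exceeds : ∀ y → Edge x y → 1# < V m y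
        exceeds y with k , ≡.refl ← enum-surjective y = proj₂ all-exceeded k

        surplus : X → Carrier
        surplus y = P x y * (V m y + - 1#)

        surplus≥0 : ∀ y → 0# ≤ surplus y
        surplus≥0 y with em {Edge x y}
        ... | yes e = *-nonneg (P≥0 x y) (≤⇒0≤∸ (<⇒≤ (exceeds y e)))
        ... | no ¬e = ≤-reflexive (≈-sym (≈-trans (*-congʳ (antisym (≮⇒≥ ¬e) (P≥0 x y))) (zeroˡ _)))

        split : ∀ y → surplus y + P x y * 1# ≈ P x y * V m y
        split y = ≈-trans (≈-sym (distribˡ _ _ _)) (*-congˡ (∸+ 1# (V m y)))

        y : X
        y = proj₁ (∃-edge x)

        1<∑ : 1# < ∑ (λ y → P x y * V m y)
        1<∑ = begin-strict
          1#                                  <⟨ x<x+y (*-pos (proj₂ (∃-edge x)) (<⇒0<∸ (exceeds y (proj₂ (∃-edge x))))) ⟩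
          1# + surplus y                      ≤⟨ +-monoʳ-≤ 1# (term≤∑ surplus≥0 y) ⟩
          1# + ∑ surplus                      ≈⟨ +-comm _ _ ⟩
          ∑ surplus + 1#                      ≈⟨ +-congˡ (∑P* x 1#) ⟨
          ∑ surplus + ∑ (λ y → P x y * 1#)    ≈⟨ ∑-+ _ _ ⟨
          ∑ (λ y → surplus y + P x y * 1#)    ≈⟨ ∑-cong split ⟩
          ∑ (λ y → P x y * V m y)             ∎

        contradiction : ⊥
        contradiction = <⇒≱ 1<∑ (≤-trans (potential-fair m x z c) (safe-at m))

      abstract
        safe-move : ∀ u → ∃ (Safe-move u)
        safe-move u = ¬¬-elim (Stuck.contradiction u)

      move : Position → Position
      move u = position (proj₁ (safe-move u)) (step B (at u) (state u) (proj₁ (safe-move u)))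
        (residual (proj₁ (safe-move u)) ∘ remaining u) (proj₂ (proj₂ (safe-move u)))

      walk : Position → Path
      walk u zero    = at u
      walk u (suc n) = walk (move u) n

      walk-positive : ∀ u → Positive (walk u)
      walk-positive u zero    = proj₁ (proj₂ (safe-move u))
      walk-positive u (suc n) = walk-positive (move u) n

      cap<1 : ∀ u n → ¬ 1# ≤ cap B (walk u n) (run B (walk u) (state u) n)
      cap<1 u zero 1≤cap = <⇒≱ (x<x+y 0<η) (begin
        1# + η                          ≤⟨ +-monoˡ-≤ η 1≤cap ⟩
        cap B (at u) (state u) + η      ≈⟨ +-congʳ (+-identityʳ _) ⟨
        potential 0 (at u) (state u) (remaining u) ≤⟨ safe u 0 ⟩
        1#                              ∎)
      cap<1 u (suc n) 1≤cap = cap<1 (move u) n 1≤cap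

      -- Once the walk has read all of `w`, its residual is `just []` of weight 1, and together with
      -- `η` the potential would exceed 1.
      uncovered : ∀ u w i → remaining u i ≡ just w → ¬ applyUpTo (walk u ∘ suc) (length w) ≡ w
      uncovered u [] i eq _ = <⇒≱ (x<x+y 0<η) (begin
        1# + η ≡⟨ ≡.cong (λ m → weightAt (at u) m + η) eq ⟨
        weightAt (at u) (remaining u i) + η
          ≤⟨ +-monoˡ-≤ η (≤-trans (last≤Σ< i (λ j → weightAt≥0 (at u) (remaining u j))) (y≤x+y (cap≥0 B (at u) (state u)))) ⟩
        potential (suc i) (at u) (state u) (remaining u) ≤⟨ safe u (suc i) ⟩
        1# ∎)
      uncovered u (y ∷ w) i eq cyl with ≡.refl , cyl′ ← ∷-injective cyl =
        uncovered (move u) w i (≡.trans (≡.cong (residual y) eq) (residual-self y w)) cyl′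

    -- If a cover of `φ` is too light, the greedy walk escapes both the cover and the bet on the
    -- complement. Missing the cover puts it outside `φ`, and not being won by the bet puts it
    -- inside.
    Outer-dual : ∀ {φ r s} → Outer (λ ω → ¬ φ ω) s → r + s ≤ 1# → LowerBound φ r
    Outer-dual {φ} {r} {s} o r+s≤1 c covers ε 0<ε = ¬¬-elim λ ¬∃ → contradiction ¬∃
      where
      contradiction : ¬ ¬ (∃ λ n → r ≤ partialSum c n + ε)
      contradiction ¬∃ with B , le , wins ← o (½ * ε) (*-pos 0<½ 0<ε) = missed
        where
        open Greedy B (½ * ε) (*-pos 0<½ 0<ε)
        origin : Position
        -- Half of ε pays for the excess of the bet over `s`, the other half for the reserve of the
        -- walk. The assumed failure at every `n` provides the whole ε.
        origin = position x₀ (init B) c λ n → begin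
          (cap B x₀ (init B) + Σ< n (weightAt x₀ ∘ c)) + ½ * ε
            ≤⟨ +-monoˡ-≤ _ (+-mono-≤ le (≤-reflexive (≈-reflexive (partialSum≡ n)))) ⟩
          ((s + ½ * ε) + partialSum c n) + ½ * ε
            ≈⟨ +-assoc _ _ _ ⟩
          (s + ½ * ε) + (partialSum c n + ½ * ε)
            ≈⟨ +-interchange s _ _ _ ⟩
          (s + partialSum c n) + (½ * ε + ½ * ε)
            ≈⟨ +-congˡ (½*x+½*x ε) ⟩
          (s + partialSum c n) + ε
            ≈⟨ +-assoc _ _ _ ⟩
          s + (partialSum c n + ε)
            ≤⟨ +-monoʳ-≤ s (<⇒≤ (≰⇒> λ r≤ → ¬∃ (n , r≤))) ⟩
          s + r ≈⟨ +-comm s r ⟩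
          r + s ≤⟨ r+s≤1 ⟩
          1# ∎
          where
          partialSum≡ : ∀ n → Σ< n (weightAt x₀ ∘ c) ≡ partialSum c n
          partialSum≡ n = sum-cong-≗ {n} (λ i → weightAt≡ (c (toℕ i)))
        ω = walk origin
        missed : ⊥
        missed with em {φ ω}
        ... | no ¬φω with n , 1≤ ← wins ω ≡.refl ¬φω = cap<1 origin n 1≤
        ... | yes φω with i , w , ci , cyl ← covers ω ≡.refl φω = uncovered origin w i ci cyl

-- Qualitative analysis of the parity condition in a finite chain

module Qual (em : ExcludedMiddle 0ℓ) (ℝ : CompleteOrderedField) where

  open Reals ℝ
  open Bets em ℝ
  open POMDPs ℝ
  open ≤-Reasoning

  module ParityChain
    {X : Set} (P : X → X → Carrier) (x₀ : X) {N : ℕ} (enum : Fin N → X)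
    (enum-surjective : ∀ x → ∃ λ k → enum k ≡ x)
    (enum-injective : ∀ {k l} → enum k ≡ enum l → k ≡ l)
    (P≥0 : ∀ x y → 0# ≤ P x y)
    (P-total : ∀ x → sum (λ k → P x (enum k)) ≈ 1#)
    {Y : Set} (label : X → Y) (p : Y → ℕ)
    where

    open MarkovChain P x₀
    open Chain P x₀ enum enum-surjective enum-injective P≥0 P-total
    open Bet

    Reach : X → X → Set
    Reach = Star Edge

    priority : X → ℕ
    priority = p ∘ label

    Good : ℕ → X → Set
    Good k x = 2 ∣ k × (∀ y → Reach x y → k ≤ℕ priority y)
                     × (∀ y → Reach x y → ∃ λ z → Reach y z × priority z ≡ k)

    Good-Reach : ∀ {k x y} → Good k x → Reach x y → Good k y
    Good-Reach (even , lower , hit) x→y = even , (λ z → lower z ∘ (x→y ◅◅_)) , λ z → hit z ∘ (x→y ◅◅_)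

    Infʸ : Path → Y → Set
    Infʸ ω s = ∀ n → ∃ λ m → n ≤ℕ m × label (ω m) ≡ s

    φ : Event
    φ ω = ∃ λ k → 2 ∣ k × (∃ λ s → Infʸ ω s × p s ≡ k) × (∀ s → Infʸ ω s → k ≤ℕ p s)

    -- Needed because the objective sees labels, whereas fairness speaks of states of the chain: a
    -- recurring label yields a recurring state that carries it.
    pigeonhole : ∀ ω {C : X → Set} → (∀ n → ∃ λ m → n ≤ℕ m × C (ω m)) → ∃ λ x → C x × Inf∞ ω x
    pigeonhole ω {C} often = ¬¬-elim absurd
      where
      finitely : ¬ (∃ λ x → C x × Inf∞ ω x) → ∀ k → ∃ λ n → C (enum k) → ∀ m → n ≤ℕ m → ω m ≢ enum k
      finitely ¬∃ k with em {C (enum k)}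
      ... | no ¬c = 0 , λ c → ⊥-elim (¬c c)
      ... | yes c with n , r ← ¬Inf⇒Fin (λ inf → ¬∃ (enum k , c , inf)) = n , λ _ → r

      absurd : ¬ ¬ ∃ λ x → C x × Inf∞ ω x
      absurd ¬∃ with n , rare ← common-bound (λ _ k≤l r c m l≤m → r c m (ℕ.≤-trans k≤l l≤m)) (finitely ¬∃)
                with m , n≤m , c ← often n
                with k , eq ← enum-surjective (ω m) = rare k (≡.subst C (≡.sym eq) c) m n≤m (≡.sym eq)

    path-Reach : ∀ {ω} → Positive ω → ∀ m k → Reach (ω m) (ω (k +ℕ m))
    path-Reach pos m zero    = done
    path-Reach pos m (suc k) = path-Reach pos m k ◅◅ (pos (k +ℕ m) ◅ done)

    path-Reach-≤ : ∀ {ω} → Positive ω → ∀ {m n} → m ≤ℕ n → Reach (ω m) (ω n)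
    path-Reach-≤ {ω} pos {m} {n} m≤n =
      ≡.subst (λ i → Reach (ω m) (ω i)) (ℕ.m∸n+n≡m m≤n) (path-Reach pos m (n ∸ m))

    Inf-Reach : ∀ {ω x y} → Fair ω → Inf∞ ω x → Reach x y → Inf∞ ω y
    Inf-Reach fair inf done      = inf
    Inf-Reach fair inf (e ◅ es) = Inf-Reach fair (fair _ _ e inf) es

    ∃Inf : ∀ ω → ∃ (Inf∞ ω)
    ∃Inf ω with x , _ , inf ← pigeonhole ω {λ x → x ≡ x} (λ n → n , ℕ.≤-refl , ≡.refl) = x , inf

    Inf-Reach-from : ∀ {ω x} → Positive ω → Inf∞ ω x → ∀ n → Reach (ω n) x
    Inf-Reach-from pos inf n with m , n≤m , ≡.refl ← inf n = path-Reach-≤ pos n≤m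

    -- Some state recurs, `k` is reachable from it, and fairness makes a state of priority `k`
    -- recur. Everything after time `n` is reachable from the good state and hence has priority at
    -- least `k`.
    Good⇒φ : ∀ {ω k n} → Fair ω → Positive ω → Good k (ω n) → φ ω
    Good⇒φ {ω} {k} {n} fair pos (even , lower , hit)
      with x , inf ← ∃Inf ω
      with z , x→z , ≡.refl ← hit x (Inf-Reach-from pos inf n) =
      k , even , (label z , inf-z , ≡.refl) , below
      where
      inf-z : Infʸ ω (label z)
      inf-z m with i , m≤i , eq ← Inf-Reach fair inf x→z m = i , m≤i , ≡.cong label eq
      below : ∀ s → Infʸ ω s → k ≤ℕ p s
      below s inf-s with m , n≤m , ≡.refl ← inf-s n = lower (ω m) (path-Reach-≤ pos n≤m)

    -- A recurring state of minimal priority is good: by fairness all that it reaches recurs too, so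
    -- it has no smaller priority, and the path returns from there to the state itself.
    φ⇒Good : ∀ {ω} → Fair ω → Positive ω → φ ω → ∃ λ n → ∃ λ k → Good k (ω n)
    φ⇒Good {ω} fair pos (k , even , (s , inf-s , ps≡k) , below)
      with x , ≡.refl , inf ← pigeonhole ω {λ x → label x ≡ s} inf-s
      with n , _ , ≡.refl ← inf 0 = n , k , even , lower , hit
      where
      lower : ∀ y → Reach (ω n) y → k ≤ℕ priority y
      lower y x→y = below (label y) λ m → let i , m≤i , eq = Inf-Reach fair inf x→y m in i , m≤i , ≡.cong label eq
      hit : ∀ y → Reach (ω n) y → ∃ λ z → Reach y z × priority z ≡ k
      hit y x→y with m , _ , ≡.refl ← Inf-Reach fair inf x→y 0 = ω n , Inf-Reach-from pos inf m , ps≡k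

    Reach-word : ∀ {x y} → Reach x y → ∃ λ w → 0# < weightFrom x w ×
      (∀ ω → ω 0 ≡ x → applyUpTo (ω ∘ suc) (length w) ≡ w → ω (length w) ≡ y)
    Reach-word done = [] , 0<1 , λ ω ω0 _ → ω0
    Reach-word (_◅_ {j = z} e es) with w , 0<w , end ← Reach-word es =
      z ∷ w , *-pos e 0<w , λ ω _ cyl → end (ω ∘ suc) (proj₁ (∷-injective cyl)) (proj₂ (∷-injective cyl))

    -- The capital is the conditional probability of leaving the cylinder: 1 minus the weight of the
    -- unread rest of `w`, and 1 after a wrong letter.
    Outer-¬Cyl : ∀ w → Outer (λ ω → ¬ ω ∈Cyl w) (1# + - weightFrom x₀ w)
    Outer-¬Cyl w ε 0<ε = bet , x≤x+y (<⇒≤ 0<ε) , λ ω _ → wins w ω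
      where
      worth : X → Maybe (List X) → Carrier
      worth x nothing  = 1#
      worth x (just v) = 1# + - weightFrom x v

      next : X → Maybe (List X) → X → Maybe (List X)
      next x nothing        y = nothing
      next x (just [])      y = just []
      next x (just (u ∷ v)) y = if does (y ≟ u) then just v else nothing

      worth≥0 : ∀ x z → 0# ≤ worth x z
      worth≥0 x nothing  = 0≤1
      worth≥0 x (just v) = ≤⇒0≤∸ (weight≤1 x v)

      next-fair : ∀ x z → ∑ (λ y → P x y * worth y (next x z y)) ≤ worth x z
      next-fair x nothing        = ≤-reflexive (∑P* x 1#)
      next-fair x (just [])      = ≤-reflexive (∑P* x (1# + - 1#))
      -- Adding the remaining weight `W` on both sides removes the subtraction, since termwise
      -- `F y + G y` is `P x y`.
      next-fair x (just (u ∷ v)) = +-cancelʳ-≤ W (begin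
        ∑ F + W                   ≤⟨ +-monoʳ-≤ _ W≤∑G ⟩
        ∑ F + ∑ G                 ≈⟨ ∑-+ F G ⟨
        ∑ (λ y → F y + G y)       ≈⟨ ∑-cong split ⟩
        ∑ (P x)                   ≈⟨ ∑P≈1 x ⟩
        1#                        ≈⟨ ∸+ W 1# ⟨
        (1# + - W) + W            ∎)
        where
        W : Carrier
        W = P x u * weightFrom u v
        F G : X → Carrier
        F y = P x y * worth y (next x (just (u ∷ v)) y)
        G y = if does (y ≟ u) then P x y * weightFrom y v else 0#
        G≥0 : ∀ y → 0# ≤ G y
        G≥0 y with y ≟ u
        ... | yes _ = *-nonneg (P≥0 x y) (weight≥0 y v)
        ... | no _  = ≤-refl
        W≤G : ∀ y → y ≡ u → W ≤ G y
        W≤G y y≡u with y ≟ u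
        W≤G y ≡.refl | yes _ = ≤-refl
        W≤G y y≡u    | no ¬eq = ⊥-elim (¬eq y≡u)
        W≤∑G : W ≤ ∑ G
        W≤∑G = ≤-trans (W≤G u ≡.refl) (term≤∑ G≥0 u)
        split : ∀ y → F y + G y ≈ P x y
        split y with y ≟ u
        ... | no _  = ≈-trans (+-identityʳ _) (*-identityʳ _)
        ... | yes _ = begin-equality
          P x y * (1# + - weightFrom y v) + P x y * weightFrom y v ≈⟨ distribˡ (P x y) _ _ ⟨
          P x y * ((1# + - weightFrom y v) + weightFrom y v) ≈⟨ *-congˡ (∸+ _ 1#) ⟩
          P x y * 1# ≈⟨ *-identityʳ _ ⟩
          P x y ∎

      bet : Bet
      bet = record
        { State = Maybe (List X) ; init = just w ; cap = worth ; step = next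
        ; cap≥0 = worth≥0 ; fair = next-fair }

      wins : ∀ v ω → ¬ applyUpTo (ω ∘ suc) (length v) ≡ v → WinsFrom bet ω (just v)
      wins [] ω ¬cyl = ⊥-elim (¬cyl ≡.refl)
      wins (u ∷ v) ω ¬cyl with em {ω 1 ≡ u}
      ... | no ω1≢u = 1 , ≤-reflexive (≈-reflexive (≡.cong (worth (ω 1)) (≡.sym off)))
        where
        off : next (ω 0) (just (u ∷ v)) (ω 1) ≡ nothing
        off with ω 1 ≟ u
        ... | yes eq = ⊥-elim (ω1≢u eq)
        ... | no _   = ≡.refl
      ... | yes ω1≡u with n , 1≤ ← wins v (ω ∘ suc) (λ cyl → ¬cyl (≡.cong₂ _∷_ ω1≡u cyl)) =
        suc n , ≡.subst (λ z → 1# ≤ worth (ω (suc n)) (run bet (ω ∘ suc) z n)) (≡.sym on) 1≤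
        where
        on : next (ω 0) (just (u ∷ v)) (ω 1) ≡ just v
        on with ω 1 ≟ u
        ... | yes _ = ≡.refl
        ... | no ¬eq = ⊥-elim (¬eq ω1≡u)

    -- The cylinder of `w` up to null events. Facts about individual regular paths thereby become
    -- bounds that involve the weight of `w`.
    Regular : List X → Event
    Regular w ω = ω ∈Cyl w × Fair ω × Positive ω

    Outer-¬Regular : ∀ w → Outer (λ ω → ¬ Regular w ω) (1# + - weightFrom x₀ w)
    Outer-¬Regular w = Outer-⊆ cases
      (Outer-≈ (≈-trans (+-congˡ (+-identityˡ 0#)) (+-identityʳ _))
        (Outer-∪ (Outer-¬Cyl w) (Outer-∪ Outer-¬Fair Outer-¬Positive)))
      where
      cases : ∀ {ω} → ω 0 ≡ x₀ → ¬ Regular w ω → ¬ ω ∈Cyl w ⊎ (¬ Fair ω ⊎ ¬ Positive ω)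
      cases {ω} _ ¬reg with em {ω ∈Cyl w} | em {Fair ω} | em {Positive ω}
      ... | no ¬c | _ | _ = inj₁ ¬c
      ... | yes _ | no ¬f | _ = inj₂ (inj₁ ¬f)
      ... | yes _ | yes _ | no ¬p = inj₂ (inj₂ ¬p)
      ... | yes c | yes f | yes p = ⊥-elim (¬reg (c , f , p))

    Regular⊆φ : ∀ w → (∀ ω → ω 0 ≡ x₀ → Regular w ω → φ ω) → LowerBound φ (weightFrom x₀ w)
    Regular⊆φ w reg⊆φ = Outer-dual (Outer-⊆ (λ ω0 ¬φω reg → ¬φω (reg⊆φ _ ω0 reg)) (Outer-¬Regular w))
      (≤-reflexive (≈-trans (+-comm _ _) (∸+ _ 1#)))

    Regular∩φ≡∅ : ∀ {r} w → (∀ ω → ω 0 ≡ x₀ → Regular w ω → ¬ φ ω) → LowerBound φ r → r + weightFrom x₀ w ≤ 1#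
    Regular∩φ≡∅ w reg⊆¬φ lb = ≤-trans
      (+-monoˡ-≤ _ (LowerBound≤Outer (Outer-⊆ (λ ω0 φω reg → reg⊆¬φ _ ω0 reg φω) (Outer-¬Regular w)) lb))
      (≤-reflexive (∸+ _ 1#))

    CanWin : X → Set
    CanWin x = ∃ λ y → Reach x y × ∃ λ k → Good k y

    lowerBound⇒canWin : ∀ {r} → 0# < r → LowerBound φ r → CanWin x₀
    lowerBound⇒canWin {r} 0<r lb = ¬¬-elim λ ¬win → <⇒≱ (x<x+y 0<r)
      (≤-trans (≤-reflexive (+-comm 1# r)) (Regular∩φ≡∅ [] (never ¬win) lb))
      where
      never : ¬ CanWin x₀ → ∀ ω → ω 0 ≡ x₀ → Regular [] ω → ¬ φ ω
      never ¬win ω ≡.refl (_ , fair , pos) φω with n , k , good ← φ⇒Good fair pos φω =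
        ¬win (ω n , path-Reach-≤ pos z≤n , k , good)

    canWin⇒lowerBound : CanWin x₀ → ∃ λ r → 0# < r × LowerBound φ r
    canWin⇒lowerBound (x , x₀→x , k , good) with w , 0<w , end ← Reach-word x₀→x =
      weightFrom x₀ w , 0<w , Regular⊆φ w λ { ω ω0 (cyl , fair , pos) →
        Good⇒φ {n = length w} fair pos (≡.subst (Good k) (≡.sym (end ω ω0 cyl)) good) }

    -- Otherwise all regular paths through a word leading to `x` would lose, and a positive weight
    -- would be missing. A good state after that word is reachable from `x`, and one before it
    -- passes goodness on to `x`.
    lowerBound1⇒canWin : LowerBound φ 1# → ∀ x → Reach x₀ x → CanWin x
    lowerBound1⇒canWin lb x x₀→x with w , 0<w , end ← Reach-word x₀→x =
      ¬¬-elim λ ¬win → <⇒≱ (x<x+y 0<w) (Regular∩φ≡∅ w (never ¬win w end) lb)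
      where
      never : ¬ CanWin x → ∀ w → (∀ ω → ω 0 ≡ x₀ → applyUpTo (ω ∘ suc) (length w) ≡ w → ω (length w) ≡ x) →
              ∀ ω → ω 0 ≡ x₀ → Regular w ω → ¬ φ ω
      never ¬win w end ω ω0 (cyl , fair , pos) φω with n , k , good ← φ⇒Good fair pos φω
        with at ← end ω ω0 cyl | ℕ.≤-total n (length w)
      ... | inj₁ n≤l = ¬win (x , done , k , Good-Reach good (≡.subst (Reach (ω n)) at (path-Reach-≤ pos n≤l)))
      ... | inj₂ l≤n = ¬win (ω n , ≡.subst (λ y → Reach y (ω n)) at (path-Reach-≤ pos l≤n) , k , good)

    -- A recurring state can reach a good one, and fairness makes the path visit it.
    canWin⇒lowerBound1 : (∀ x → Reach x₀ x → CanWin x) → LowerBound φ 1#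
    canWin⇒lowerBound1 win = Regular⊆φ [] always
      where
      always : ∀ ω → ω 0 ≡ x₀ → Regular [] ω → φ ω
      always ω ≡.refl (_ , fair , pos)
        with x , inf ← ∃Inf ω
        with y , x→y , k , good ← win x (Inf-Reach-from pos inf 0)
        with n , _ , ≡.refl ← Inf-Reach fair inf x→y 0 = Good⇒φ {n = n} fair pos good

    LowerBound≤1 : ∀ {r} → LowerBound φ r → r ≤ 1#
    LowerBound≤1 = LowerBound≤Outer λ ε 0<ε →
      constant 1# 0≤1 , x≤x+y (<⇒≤ 0<ε) , λ _ _ _ → 0 , ≤-refl

    LowerBound-0 : LowerBound φ 0#
    LowerBound-0 c _ ε 0<ε = 0 , +-nonneg ≤-refl (<⇒≤ 0<ε)

    -- Positive winning asks for an exact value, namely the supremum of the lower bounds. It is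
    -- itself a lower bound: a cover lighter than it by ε would make the supremum minus ε/2 an upper
    -- bound of them.
    Pr-exists : ∃ λ r → Pr[ φ ]≈ r
    Pr-exists with s , ub , least ← supremum (LowerBound φ) (0# , LowerBound-0) (1# , λ _ → LowerBound≤1) =
      s , attained s least , ub
      where
      attained : ∀ s → (∀ b → UpperBound (LowerBound φ) b → s ≤ b) → LowerBound φ s
      attained s least c covers ε 0<ε = ¬¬-elim λ ¬∃ → <⇒≱ (x<x+y 0<½ε)
        (≤-trans (+-monoˡ-≤ (½ * ε) (least (s + - (½ * ε)) (bounded ¬∃))) (≤-reflexive (∸+ (½ * ε) s)))
        where
        0<½ε : 0# < ½ * ε
        0<½ε = *-pos 0<½ 0<ε
        bounded : ¬ (∃ λ n → s ≤ partialSum c n + ε) → UpperBound (LowerBound φ) (s + - (½ * ε))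
        bounded ¬∃ r lb with n , r≤ ← lb c covers (½ * ε) 0<½ε = +-cancelʳ-≤ (½ * ε) (begin
          r + ½ * ε                          ≤⟨ +-monoˡ-≤ _ r≤ ⟩
          (partialSum c n + ½ * ε) + ½ * ε   ≈⟨ +-assoc _ _ _ ⟩
          partialSum c n + (½ * ε + ½ * ε)   ≈⟨ +-congˡ (½*x+½*x ε) ⟩
          partialSum c n + ε                 ≤⟨ <⇒≤ (≰⇒> λ s≤ → ¬∃ (n , s≤)) ⟩
          s                                  ≈⟨ ∸+ (½ * ε) s ⟨
          (s + - (½ * ε)) + ½ * ε            ∎)

    Wins-in : Mode → Set
    Wins-in almost-sure = Pr[ φ ]≈ 1#
    Wins-in positive    = ∃ λ r → (Pr[ φ ]≈ r) × 0# < r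

    CanWin-in : Mode → Set
    CanWin-in almost-sure = ∀ x → Reach x₀ x → CanWin x
    CanWin-in positive    = CanWin x₀

    abstract
      wins⇒canWin : ∀ mode → Wins-in mode → CanWin-in mode
      wins⇒canWin almost-sure (lb , _)           = lowerBound1⇒canWin lb
      wins⇒canWin positive    (r , (lb , _) , 0<r) = lowerBound⇒canWin 0<r lb

      canWin⇒wins : ∀ mode → CanWin-in mode → Wins-in mode
      canWin⇒wins almost-sure win = canWin⇒lowerBound1 win , λ _ → LowerBound≤1
      canWin⇒wins positive    win =
        let r , 0<r , lb = canWin⇒lowerBound win
            s , pr       = Pr-exists
        in s , pr , <-≤-trans 0<r (proj₂ pr r lb)

-- The finite chain induced by a controller

module Strat (em : ExcludedMiddle 0ℓ) (ℝ : CompleteOrderedField) where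

  open Reals ℝ
  open POMDPs ℝ
  open ≤-Reasoning

  -- Memory enters through an enumeration so that memory states in `Fin` and beliefs, which are
  -- subsets, share one analysis.
  module ControllerChain
    (G : POMDP) (π : PriorityFunction G) (C : Controller G)
    {n : ℕ} (enum : Fin n → Controller.Memory C)
    (enum-surjective : ∀ m → ∃ λ k → enum k ≡ m)
    (enum-injective : ∀ {k l} → enum k ≡ enum l → k ≡ l)
    (update≥0 : ∀ m o a m′ → 0# ≤ Controller.update C m o a m′)
    (update-total : ∀ m o a → sum (λ k → Controller.update C m o a (enum k)) ≈ 1#)
    where

    open POMDP G
    open Controller C
    open PriorityFunction π using (p)

    X : Set
    X = Fin |S| × Memory

    enumˣ : Fin (|S| *ℕ n) → X
    enumˣ k = proj₁ (remQuot {|S|} n k) , enum (proj₂ (remQuot {|S|} n k))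

    move : X → X → Fin |A| → Carrier
    move (s , m) (s′ , m′) a = pr (select m) a * pr (δ s a) s′ * update m (γ s′) a m′

    move≥0 : ∀ x y a → 0# ≤ move x y a
    move≥0 (s , m) (s′ , m′) a =
      *-nonneg (*-nonneg (nonneg (select m) a) (nonneg (δ s a) s′)) (update≥0 m (γ s′) a m′)

    Step : X → X → Set
    Step (s , m) (s′ , m′) = ∃ λ a → Supp (select m) a × Supp (δ s a) s′ × 0# < update m (γ s′) a m′

    abstract
      enumˣ-surjective : ∀ x → ∃ λ k → enumˣ k ≡ x
      enumˣ-surjective (s , m) with k , ≡.refl ← enum-surjective m = combine s k ,
        ≡.cong₂ _,_ (≡.cong proj₁ (remQuot-combine s k)) (≡.cong (enum ∘ proj₂) (remQuot-combine s k))

      enumˣ-injective : ∀ {k l} → enumˣ k ≡ enumˣ l → k ≡ l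
      enumˣ-injective {k} {l} eq =
        let eqˢ , eqᴹ = ,-injective eq in
        ≡.trans (≡.sym (combine-remQuot {|S|} n k))
          (≡.trans (≡.cong₂ combine eqˢ (enum-injective eqᴹ)) (combine-remQuot {|S|} n l))

      δσ≥0 : ∀ x y → 0# ≤ δσ x y
      δσ≥0 x y = sum-nonneg {|A|} (move≥0 x y)

      -- The update distribution depends on the new state and the action, so memory is summed out
      -- first, then states, then actions.
      δσ-total : ∀ x → sum (λ k → δσ x (enumˣ k)) ≈ 1#
      δσ-total x@(s , m) = begin-equality
        sum (λ k → δσ x (enumˣ k))
          ≈⟨ sum-combine |S| (λ k → δσ x (enumˣ k)) ⟩
        sum {|S|} (λ s′ → sum {n} (λ k → δσ x (enumˣ (combine s′ k))))
          ≈⟨ sum-cong {|S|} (λ s′ → sum-cong {n} (λ k → ≈-reflexive (≡.cong (λ r → δσ x (proj₁ r , enum (proj₂ r))) (remQuot-combine s′ k)))) ⟩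
        sum {|S|} (λ s′ → sum {n} (λ k → sum {|A|} (λ a → move x (s′ , enum k) a)))
          ≈⟨ sum-cong {|S|} (λ s′ → ∑-comm {n} {|A|} (λ k a → move x (s′ , enum k) a)) ⟩
        sum {|S|} (λ s′ → sum {|A|} (λ a → sum {n} (λ k → move x (s′ , enum k) a)))
          ≈⟨ sum-cong {|S|} (λ s′ → sum-cong {|A|} (λ a → factor s′ a)) ⟩
        sum {|S|} (λ s′ → sum {|A|} (λ a → pr (select m) a * pr (δ s a) s′))
          ≈⟨ ∑-comm {|S|} {|A|} (λ s′ a → pr (select m) a * pr (δ s a) s′) ⟩
        sum {|A|} (λ a → sum {|S|} (λ s′ → pr (select m) a * pr (δ s a) s′))
          ≈⟨ sum-cong {|A|} (λ a → factor′ a) ⟩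
        sum (pr (select m))
          ≈⟨ total (select m) ⟩
        1# ∎
        where
        factor : ∀ s′ a → sum {n} (λ k → move x (s′ , enum k) a) ≈ pr (select m) a * pr (δ s a) s′
        factor s′ a = begin-equality
          sum {n} (λ k → pr (select m) a * pr (δ s a) s′ * update m (γ s′) a (enum k))
            ≈⟨ *-distribˡ-sum {n} (pr (select m) a * pr (δ s a) s′) (λ k → update m (γ s′) a (enum k)) ⟨
          pr (select m) a * pr (δ s a) s′ * sum {n} (λ k → update m (γ s′) a (enum k))
            ≈⟨ *-congˡ (update-total m (γ s′) a) ⟩
          pr (select m) a * pr (δ s a) s′ * 1# ≈⟨ *-identityʳ _ ⟩
          pr (select m) a * pr (δ s a) s′ ∎
        factor′ : ∀ a → sum {|S|} (λ s′ → pr (select m) a * pr (δ s a) s′) ≈ pr (select m) a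
        factor′ a = begin-equality
          sum {|S|} (λ s′ → pr (select m) a * pr (δ s a) s′) ≈⟨ *-distribˡ-sum {|S|} (pr (select m) a) (pr (δ s a)) ⟨
          pr (select m) a * sum (pr (δ s a)) ≈⟨ *-congˡ (total (δ s a)) ⟩
          pr (select m) a * 1# ≈⟨ *-identityʳ _ ⟩
          pr (select m) a ∎

      δσ-pos⇒Step : ∀ {x y} → 0# < δσ x y → Step x y
      δσ-pos⇒Step {x@(s , m)} {y@(s′ , m′)} 0<δσ =
        let a , 0<move = sum-pos⇒ {|A|} {move x y} 0<δσ
            0<nδ = *-posˡ (*-nonneg (nonneg (select m) a) (nonneg (δ s a) s′)) 0<move
        in a , *-posˡ (nonneg (select m) a) 0<nδ , *-posʳ (nonneg (δ s a) s′) 0<nδ ,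
           *-posʳ (update≥0 m (γ s′) a m′) 0<move

      Step⇒δσ-pos : ∀ {x y} → Step x y → 0# < δσ x y
      Step⇒δσ-pos {x@(s , m)} {y@(s′ , m′)} (a , 0<n , 0<δ , 0<u) =
        <-≤-trans (*-pos (*-pos 0<n 0<δ) 0<u) (term≤sum {|A|} {move x y} (move≥0 x y) a)

    module Chain = Qual.ParityChain em ℝ δσ (s₀ , m₀) enumˣ enumˣ-surjective enumˣ-injective δσ≥0 δσ-total proj₁ p
    open Chain public using (Good; CanWin; CanWin-in; Reach; Good-Reach)

    abstract
      winning⇒canWin : ∀ mode → WinningController G mode π C → CanWin-in mode
      winning⇒canWin almost-sure = Chain.wins⇒canWin almost-sure
      winning⇒canWin positive    = Chain.wins⇒canWin positive

      canWin⇒winning : ∀ mode → CanWin-in mode → WinningController G mode π C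
      canWin⇒winning almost-sure = Chain.canWin⇒wins almost-sure
      canWin⇒winning positive    = Chain.canWin⇒wins positive

  module StrategyChain (G : POMDP) (π : PriorityFunction G) (σ : FMStrategy G) where

    open FMStrategy σ

    open ControllerChain G π controller (λ k → k) (λ m → m , ≡.refl) (λ eq → eq)
      (λ m o a → nonneg (σu m o a)) (λ m o a → total (σu m o a)) public

-- Uniform distributions with prescribed support

module Dists (em : ExcludedMiddle 0ℓ) (ℝ : CompleteOrderedField) where

  open Reals ℝ
  open POMDPs ℝ
  open ≤-Reasoning
  open import Algebra.Properties.Semiring.Mult semiring using (×-comm-*; ×-assoc-*; ×-congʳ; ×-homo-+)

  module Uniform {n : ℕ} (Q : Fin n → Set) (∃Q : ∃ Q) where

    indicator : Fin n → Carrier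
    indicator i = if does (em {Q i}) then 1# else 0#

    indicator≥0 : ∀ i → 0# ≤ indicator i
    indicator≥0 i with em {Q i}
    ... | yes _ = 0≤1
    ... | no _  = ≤-refl

    indicator⁺ : ∀ i → Q i → 0# < indicator i
    indicator⁺ i q with em {Q i}
    ... | yes _ = 0<1
    ... | no ¬q = ⊥-elim (¬q q)

    indicator⁻ : ∀ i → 0# < indicator i → Q i
    indicator⁻ i 0< with em {Q i}
    ... | yes q = q
    ... | no _  = ⊥-elim (<⇒≱ 0< ≤-refl)

    abstract
      scale : ∃ λ r → 0# < r × sum indicator * r ≈ 1#
      scale = inverse-pos (<-≤-trans (indicator⁺ _ (proj₂ ∃Q)) (term≤sum indicator≥0 (proj₁ ∃Q)))

    r : Carrier
    r = proj₁ scale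

    uniform : Dist n
    uniform = record
      { pr     = λ i → indicator i * r
      ; nonneg = λ i → *-nonneg (indicator≥0 i) (<⇒≤ (proj₁ (proj₂ scale)))
      ; total  = ≈-trans (≈-sym (*-distribʳ-sum r indicator)) (proj₂ (proj₂ scale)) }

    Supp-uniform⁺ : ∀ {i} → Q i → Supp uniform i
    Supp-uniform⁺ q = *-pos (indicator⁺ _ q) (proj₁ (proj₂ scale))

    Supp-uniform⁻ : ∀ {i} → Supp uniform i → Q i
    Supp-uniform⁻ 0< = indicator⁻ _ (*-posˡ (indicator≥0 _) 0<)

    counted : ∀ {m} (f : Fin m → Carrier) → (∀ i → ∃ λ u → u ≤ℕ 1 × f i ≈ u · 1#) → ∃ λ c → c ≤ℕ m × sum f ≈ c · 1#
    counted {zero}  f h = 0 , z≤n , ≈-refl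
    counted {suc m} f h with u , u≤1 , f0 ← h zero | c , c≤m , rest ← counted (f ∘ suc) (h ∘ suc) =
      u +ℕ c , ℕ.+-mono-≤ u≤1 c≤m , ≈-trans (+-cong f0 rest) (≈-sym (×-homo-+ 1# u c))

    bit : ∀ i → ∃ λ u → u ≤ℕ 1 × indicator i ≈ u · 1#
    bit i with em {Q i}
    ... | yes _ = 1 , s≤s z≤n , ≈-sym (+-identityʳ 1#)
    ... | no _  = 0 , z≤n , ≈-refl

    abstract
      -- The denominator is the number of elements of `Q`. It is not 0, as the indicators scaled by
      -- `r` sum to 1.
      uniform-rational : ∀ i → ∃ λ u → ∃ λ v → 1 ≤ℕ v × u ≤ℕ 1 × v ≤ℕ n × v · pr uniform i ≈ u · 1#
      uniform-rational i =
        let c , c≤n , sum≈c  = counted indicator bit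
            u , u≤1 , ind≈u  = bit i
        in u , c , c≥1 c sum≈c , u≤1 , c≤n , scaled c u sum≈c ind≈u
        where
        c≥1 : ∀ c → sum indicator ≈ c · 1# → 1 ≤ℕ c
        c≥1 (suc c) _ = s≤s z≤n
        c≥1 zero sum≈0 = ⊥-elim (0≉1 (begin-equality
          0#                ≈⟨ zeroˡ r ⟨
          0# * r            ≈⟨ *-congʳ sum≈0 ⟨
          sum indicator * r ≈⟨ proj₂ (proj₂ scale) ⟩
          1#                ∎))
        scaled : ∀ c u → sum indicator ≈ c · 1# → indicator i ≈ u · 1# → c · (indicator i * r) ≈ u · 1#
        scaled c u sum≈c ind≈u = begin-equality
          c · (indicator i * r)            ≈⟨ ×-comm-* c (indicator i) r ⟨
          indicator i * (c · r)            ≈⟨ *-congˡ (×-congʳ c (*-identityˡ r)) ⟨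
          indicator i * (c · (1# * r))     ≈⟨ *-congˡ (×-assoc-* c 1# r) ⟨
          indicator i * ((c · 1#) * r)     ≈⟨ *-congˡ (*-congʳ sum≈c) ⟨
          indicator i * (sum indicator * r) ≈⟨ *-congˡ (proj₂ (proj₂ scale)) ⟩
          indicator i * 1#                 ≈⟨ *-identityʳ _ ⟩
          indicator i                      ≈⟨ ind≈u ⟩
          u · 1#                           ∎

  Supp-nonempty : ∀ {n} (f : Dist n) → ∃ (Supp f)
  Supp-nonempty f = sum-pos⇒ (<-≤-trans 0<1 (≤-reflexive (≈-sym (total f))))

  abstract
    -- The fallback `f` serves classes without members and actions that no member of a class plays.
    uniformOr : ∀ {n} → Dist n → (Fin n → Set) → Dist n
    uniformOr f Q with em {∃ Q}
    ... | yes ∃Q = Uniform.uniform Q ∃Q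
    ... | no _   = f

    Supp-uniformOr⁺ : ∀ {n} (f : Dist n) Q {i} → Q i → Supp (uniformOr f Q) i
    Supp-uniformOr⁺ f Q q with em {∃ Q}
    ... | yes ∃Q = Uniform.Supp-uniform⁺ Q ∃Q q
    ... | no ¬∃Q = ⊥-elim (¬∃Q (_ , q))

    Supp-uniformOr⁻ : ∀ {n} (f : Dist n) Q → ∃ Q → ∀ {i} → Supp (uniformOr f Q) i → Q i
    Supp-uniformOr⁻ f Q ∃Q 0< with em {∃ Q}
    ... | yes ∃Q = Uniform.Supp-uniform⁻ Q ∃Q 0<
    ... | no ¬∃Q = ⊥-elim (¬∃Q ∃Q)

  point : ∀ {n} → Fin n → Dist n
  point i = Uniform.uniform (_≡ i) (i , ≡.refl)

  Supp-point : ∀ {n} (i : Fin n) → Supp (point i) i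
  Supp-point i = Uniform.Supp-uniform⁺ (_≡ i) (i , ≡.refl) ≡.refl

  Supp-point⁻ : ∀ {n} {i j : Fin n} → Supp (point i) j → j ≡ i
  Supp-point⁻ {i = i} = Uniform.Supp-uniform⁻ (_≡ i) (i , ≡.refl)

  record Graph : Set₁ where
    field
      |S| |A| |O| : ℕ
      Succ        : Fin |S| → Fin |A| → Fin |S| → Set
      ∃Succ       : ∀ s a → ∃ (Succ s a)
      γ           : Fin |S| → Fin |O|
      s₀          : Fin |S|
      γ-initial   : ∀ s → γ s ≡ γ s₀ → s ≡ s₀

    pomdp : POMDP
    pomdp = record
      { |S| = |S| ; |A| = |A| ; |O| = |O| ; δ = λ s a → Uniform.uniform (Succ s a) (∃Succ s a)
      ; γ = γ ; s₀ = s₀ ; γ-initial = γ-initial }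

    abstract
      Supp⁺ : ∀ {s a s′} → Succ s a s′ → Supp (POMDP.δ pomdp s a) s′
      Supp⁺ {s} {a} = Uniform.Supp-uniform⁺ (Succ s a) (∃Succ s a)

      Supp⁻ : ∀ {s a s′} → Supp (POMDP.δ pomdp s a) s′ → Succ s a s′
      Supp⁻ {s} {a} = Uniform.Supp-uniform⁻ (Succ s a) (∃Succ s a)

-- Merging memory states

module Quot (em : ExcludedMiddle 0ℓ) (ℝ : CompleteOrderedField) where

  open Reals ℝ
  open POMDPs ℝ
  open Strat em ℝ
  open Dists em ℝ

  -- The merged strategy plays uniformly over everything that some memory state of the
  -- class may do, so that its edges are exactly the images of the original ones.
  module Quotient (G : POMDP) (π : PriorityFunction G) (σ : FMStrategy G)
                  {n : ℕ} (cls : Fin (FMStrategy.|M| σ) → Fin n) where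

    open POMDP G
    open FMStrategy σ

    Selects : Fin n → Fin |A| → Set
    Selects q a = ∃ λ m → cls m ≡ q × Supp (σn m) a

    -- The member that updates must also play `a`; otherwise its reaction to an action it never
    -- chooses would create an edge that has no original.
    Updates : Fin n → Fin |O| → Fin |A| → Fin n → Set
    Updates q o a q′ = ∃ λ m → ∃ λ m′ → cls m ≡ q × Supp (σn m) a × Supp (σu m o a) m′ × cls m′ ≡ q′

    any : Dist n
    any = Uniform.uniform (λ _ → ⊤) (cls m₀ , tt)

    σ′ : FMStrategy G
    σ′ = record
      { |M| = n
      ; m₀  = cls m₀
      ; σn  = λ q → uniformOr (σn m₀) (Selects q)
      ; σu  = λ q o a → uniformOr any (Updates q o a)
      }

    module C  = StrategyChain G π σ
    module C′ = StrategyChain G π σ′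

    cl : C.X → C′.X
    cl (s , m) = s , cls m

    project-Step : ∀ {x y} → C.Step x y → C′.Step (cl x) (cl y)
    project-Step {s , m} {s′ , m′} (a , n>0 , δ>0 , u>0) =
      a , Supp-uniformOr⁺ (σn m₀) (Selects (cls m)) (m , ≡.refl , n>0) , δ>0 ,
      Supp-uniformOr⁺ any (Updates (cls m) (γ s′) a) (m , m′ , ≡.refl , n>0 , u>0 , ≡.refl)

    -- Action and update are drawn separately, so the edge may start at another member `m₁` than
    -- `m`. Exhibiting some member that plays `a`, together with one of its updates, rules out the
    -- fallback of `uniformOr`; the support then names the member to use.
    lift-Step : ∀ {s m y′} → C′.Step (s , cls m) y′ →
                ∃ λ m₁ → ∃ λ y → cls m₁ ≡ cls m × cl y ≡ y′ × C.Step (s , m₁) y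
    lift-Step {s} {m} {s′ , q′} (a , n>0 , δ>0 , u>0) =
      let b , b∈ = Supp-nonempty (σn m)
          m₁ , m₁∈ , a∈ = Supp-uniformOr⁻ (σn m₀) (Selects (cls m)) (b , m , ≡.refl , b∈) n>0
          m₂ , m₂∈ = Supp-nonempty (σu m₁ (γ s′) a)
          m₃ , m′ , m₃∈ , a∈₃ , m′∈ , eq =
            Supp-uniformOr⁻ any (Updates (cls m) (γ s′) a) (cls m₂ , m₁ , m₂ , m₁∈ , a∈ , m₂∈ , ≡.refl) u>0
      in m₃ , (s′ , m′) , m₃∈ , ≡.cong (s′ ,_) eq , a , a∈₃ , δ>0 , m′∈

    project-Reach : ∀ {x y} → C.Reach x y → C′.Reach (cl x) (cl y)
    project-Reach = gmap cl (C′.Step⇒δσ-pos ∘ project-Step ∘ C.δσ-pos⇒Step)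

    -- Each lifted edge may start after a jump within the class, so what is carried along a path is
    -- not a path of the original chain but the property `R`.
    module Invariant (R : C.X → Set) (R-cls : ∀ {s m m₁} → cls m₁ ≡ cls m → R (s , m) → R (s , m₁))
                     (R-Reach : ∀ {x y} → R x → C.Reach x y → R y) where

      lift : ∀ {x y′} → R x → C′.Reach (cl x) y′ → ∃ λ y → cl y ≡ y′ × R y
      lift {x} Rx done = x , ≡.refl , Rx
      lift {x} Rx (e ◅ es) with m₁ , y , eq₁ , ≡.refl , step ← lift-Step (C′.δσ-pos⇒Step e) =
        lift (R-Reach (R-cls eq₁ Rx) (C.Step⇒δσ-pos step ◅ done)) es

    -- Every state reached in the quotient has a good lift. Its bound is read off at the lift
    -- itself, and its path to priority `k` is projected back.
    project-Good : ∀ {k x} → (∀ {s m m₁} → cls m₁ ≡ cls m → C.Good k (s , m) → C.Good k (s , m₁)) →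
                   C.Good k x → C′.Good k (cl x)
    project-Good {k} {x} Good-cls good@(even , _) = even , lower , hit
      where
      open Invariant (C.Good k) Good-cls C.Good-Reach
      lower : ∀ y → C′.Reach (cl x) y → k ≤ℕ _
      lower y x→y with z , ≡.refl , (_ , lo , _) ← lift good x→y = lo z done
      hit : ∀ y → C′.Reach (cl x) y → ∃ λ z → C′.Reach y z × _ ≡ k
      hit y x→y with z , ≡.refl , (_ , _ , h) ← lift good x→y with w , z→w , eq ← h z done =
        cl w , project-Reach z→w , eq

  module SmallMemory (G : POMDP) (π : PriorityFunction G) (σ : FMStrategy G) where

    open POMDP G
    open PriorityFunction π
    open FMStrategy σ
    open StrategyChain G π σ

    AlwaysCanWin : X → Set
    AlwaysCanWin x = ∀ y → Reach x y → CanWin y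

    -- What a class records for each state of the POMDP: almost-sure winning at index `zero`, and
    -- goodness for each of the `d` priorities.
    Property : Fin (suc d) → X → Set
    Property zero    = AlwaysCanWin
    Property (suc i) = Good (lookup D i)

    bit : Set → Fin 2
    bit B = if does (em {B}) then suc zero else zero

    bit-≡ : ∀ {A B : Set} → bit A ≡ bit B → A → B
    bit-≡ {A} {B} eq a with em {A} | em {B}
    ... | _     | yes b = b
    ... | yes _ | no _  with () ← eq
    ... | no ¬a | no _  = ⊥-elim (¬a a)

    bits : Fin |M| → Fin (|S| *ℕ suc d) → Fin 2
    bits m k = let s , j = remQuot {|S|} (suc d) k in bit (Property j (s , m))

    cls : Fin |M| → Fin (2 ^ (|S| *ℕ suc d))
    cls m = funToFin (bits m)

    Property-cls : ∀ j {s m m₁} → cls m₁ ≡ cls m → Property j (s , m) → Property j (s , m₁)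
    Property-cls j {s} {m} {m₁} eq = bit-≡ (≡.trans (≡.sym (at m)) (≡.trans (same (combine s j)) (at m₁)))
      where
      same : ∀ k → bits m k ≡ bits m₁ k
      same k = ≡.trans (≡.sym (finToFun-funToFin (bits m) k))
        (≡.trans (≡.cong (λ q → finToFun q k) (≡.sym eq)) (finToFun-funToFin (bits m₁) k))
      at : ∀ m → bits m (combine s j) ≡ bit (Property j (s , m))
      at m = ≡.cong (λ { (s , j) → bit (Property j (s , m)) }) (remQuot-combine {|S|} s j)

    open Quotient G π σ cls using (σ′; cl; project-Good; project-Reach; module Invariant; module C′) public

    project-CanWin : ∀ {x} → CanWin x → C′.CanWin (cl x)
    -- A `k` with a good state is the priority of some reachable state, hence lies in `D` and has
    -- its own bit.
    project-CanWin (y , x→y , k , good@(_ , _ , hit)) with z , _ , eq ← hit y done =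
      cl y , project-Reach x→y , k ,
      project-Good (λ {s} {m} {m₁} → ≡.subst (λ k → _ → Good k (s , m) → Good k (s , m₁)) k≡ (Property-cls (suc i))) good
      where
      i = index (p∈D (proj₁ z))
      k≡ : lookup D i ≡ k
      k≡ = ≡.trans (≡.sym (lookup-index (p∈D (proj₁ z)))) eq

    module AlwaysCanWin = Invariant AlwaysCanWin (Property-cls zero) (λ W x→y z y→z → W z (x→y ◅◅ y→z))

    project-CanWin-in : ∀ mode → CanWin-in mode → C′.CanWin-in mode
    project-CanWin-in positive    = project-CanWin
    project-CanWin-in almost-sure W x x₀→x with y , ≡.refl , Wy ← AlwaysCanWin.lift W x₀→x =
      project-CanWin (Wy y done)

    -- The priority of `s₀` supplies the element of `Fin d`, which excludes `d = 0`; this is how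
    -- `1 + d` fits under the factor `3 * d`.
    d≥1 : ∀ {d} → Fin d → suc d ≤ℕ 3 *ℕ d
    d≥1 {suc d} _ = ℕ.≤-trans (s≤s (ℕ.m≤n+m (suc d) d)) (s≤s (ℕ.+-monoʳ-≤ d (ℕ.m≤m+n (suc d) _)))

    |M|-bound : 2 ^ (|S| *ℕ suc d) ≤ℕ 2 ^ (3 *ℕ d *ℕ |S|)
    |M|-bound = ℕ.^-monoʳ-≤ 2 (ℕ.≤-trans (ℕ.*-monoʳ-≤ |S| (d≥1 (index (p∈D s₀))))
      (ℕ.≤-reflexive (ℕ.*-comm |S| (3 *ℕ d))))

  small-memory : ∀ mode (G : POMDP) (π : PriorityFunction G) → (∃ λ σ → Winning G mode π σ) →
    ∃ λ σ → Winning G mode π σ × FMStrategy.|M| σ ≤ℕ 2 ^ (3 *ℕ PriorityFunction.d π *ℕ POMDP.|S| G)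
  small-memory mode G π (σ , win) = σ′ ,
    C′.canWin⇒winning mode (project-CanWin-in mode (StrategyChain.winning⇒canWin G π σ mode win)) , |M|-bound
    where open SmallMemory G π σ

-- Belief-based strategies and their insufficiency

module Belief (em : ExcludedMiddle 0ℓ) (ℝ : CompleteOrderedField) where

  open Reals ℝ
  open POMDPs ℝ
  open Strat em ℝ
  open Dists em ℝ

  funToFin-cong : ∀ {m n} {f g : Fin m → Fin n} → (∀ i → f i ≡ g i) → funToFin f ≡ funToFin g
  funToFin-cong {zero}  eq = ≡.refl
  funToFin-cong {suc m} eq = ≡.cong₂ combine (eq zero) (funToFin-cong (eq ∘ suc))

  finToFun-injective : ∀ {m n} {k l : Fin (n ^ m)} → (∀ i → finToFun {n} {m} k i ≡ finToFun l i) → k ≡ l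
  finToFun-injective {m} {n} {k} {l} eq =
    ≡.trans (≡.sym (funToFin-finToFin {m} {n} k)) (≡.trans (funToFin-cong eq) (funToFin-finToFin {m} {n} l))

  toBool : Fin 2 → Bool
  toBool 0F = false
  toBool 1F = true

  fromBool : Bool → Fin 2
  fromBool false = 0F
  fromBool true  = 1F

  toBool-fromBool : ∀ b → toBool (fromBool b) ≡ b
  toBool-fromBool false = ≡.refl
  toBool-fromBool true  = ≡.refl

  fromBool-toBool : ∀ i → fromBool (toBool i) ≡ i
  fromBool-toBool 0F = ≡.refl
  fromBool-toBool 1F = ≡.refl

  subset : ∀ {n} → Fin (2 ^ n) → Subset n
  subset k = Vec.tabulate (toBool ∘ finToFun k)

  subset-surjective : ∀ {n} (Y : Subset n) → ∃ λ k → subset k ≡ Y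
  subset-surjective Y = funToFin (fromBool ∘ Vec.lookup Y) ,
    ≡.trans (tabulate-cong λ i → ≡.trans (≡.cong toBool (finToFun-funToFin (fromBool ∘ Vec.lookup Y) i)) (toBool-fromBool _))
      (tabulate∘lookup Y)

  subset-injective : ∀ {n} {k l : Fin (2 ^ n)} → subset {n} k ≡ subset l → k ≡ l
  subset-injective {n} {k} {l} eq = finToFun-injective λ i →
    ≡.trans (≡.sym (fromBool-toBool _)) (≡.trans (≡.cong fromBool (at i)) (fromBool-toBool _))
    where
    at : ∀ i → toBool (finToFun k i) ≡ toBool (finToFun l i)
    at i = ≡.trans (≡.sym (lookup∘tabulate (toBool ∘ finToFun k) i))
      (≡.trans (≡.cong (λ Y → Vec.lookup Y i) eq) (lookup∘tabulate (toBool ∘ finToFun l) i))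

  module BeliefChain (G : POMDP) (π : PriorityFunction G) (b : BeliefStrategy G) where

    open POMDP G

    private
      upd : Subset |S| → Fin |O| → Fin |A| → Subset |S| → Carrier
      upd Y o a Y′ = if does (_≟ᴮ_ G Y′ (updateBelief G Y o a)) then 1# else 0#

    abstract
      upd≥0 : ∀ Y o a Y′ → 0# ≤ upd Y o a Y′
      upd≥0 Y o a Y′ with does (_≟ᴮ_ G Y′ (updateBelief G Y o a))
      ... | true  = 0≤1
      ... | false = ≤-refl

      upd-other : ∀ Y o a Y′ → Y′ ≢ updateBelief G Y o a → upd Y o a Y′ ≈ 0#
      upd-other Y o a Y′ ≢U with _≟ᴮ_ G Y′ (updateBelief G Y o a)
      ... | yes ≡U = ⊥-elim (≢U ≡U)
      ... | no _   = ≈-refl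

      upd-self : ∀ Y o a Y′ → Y′ ≡ updateBelief G Y o a → upd Y o a Y′ ≈ 1#
      upd-self Y o a Y′ ≡U with _≟ᴮ_ G Y′ (updateBelief G Y o a)
      ... | yes _ = ≈-refl
      ... | no ≢U = ⊥-elim (≢U ≡U)

      upd-total : ∀ Y o a → sum (λ k → upd Y o a (subset k)) ≈ 1#
      upd-total Y o a with k , eq ← subset-surjective (updateBelief G Y o a) =
        ≈-trans (sum-single k (λ l l≢k → upd-other Y o a (subset l) (λ eq′ → l≢k (subset-injective (≡.trans eq′ (≡.sym eq))))))
          (upd-self Y o a (subset k) eq)

    open ControllerChain G π (beliefController G b) subset subset-surjective subset-injective upd≥0 upd-total public

    abstract
      belief-Step⁻ : ∀ {s Y s′ Y′} → Step (s , Y) (s′ , Y′) →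
                     ∃ λ a → Supp (δ s a) s′ × Y′ ≡ updateBelief G Y (γ s′) a
      belief-Step⁻ {s} {Y} {s′} {Y′} (a , _ , δ>0 , u>0) = a , δ>0 , eq
        where
        eq : Y′ ≡ updateBelief G Y (γ s′) a
        eq = decidable-stable (_≟ᴮ_ G Y′ (updateBelief G Y (γ s′) a)) λ ≢U →
          ⊥-elim (<⇒≱ u>0 (≤-reflexive (upd-other Y (γ s′) a Y′ ≢U)))

      belief-Step⁺ : ∀ {s Y s′ Y′ a} → Supp (b Y) a → Supp (δ s a) s′ → Y′ ≡ updateBelief G Y (γ s′) a →
                     Step (s , Y) (s′ , Y′)
      belief-Step⁺ {a = a} a∈ δ>0 eq = a , a∈ , δ>0 , <-≤-trans 0<1 (≤-reflexive (≈-sym (upd-self _ _ _ _ eq)))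

  abstract
    updateBelief-≡ : ∀ (G : POMDP) Y o a (B : Subset (POMDP.|S| G)) → let open POMDP G in
      (∀ s′ → s′ ∈ˢ B → γ s′ ≡ o × ∃ λ s → s ∈ˢ Y × Supp (δ s a) s′) →
      (∀ s′ → γ s′ ≡ o × (∃ λ s → s ∈ˢ Y × Supp (δ s a) s′) → s′ ∈ˢ B) →
      updateBelief G Y o a ≡ B
    updateBelief-≡ G Y o a B sound complete = ≡.trans (tabulate-cong at) (tabulate∘lookup B)
      where
      open POMDP G
      at : ∀ s′ → does ((γ s′ ≟ᶠ o) ×-dec any? (λ s → (s ∈? Y) ×-dec Supp? (δ s a) s′)) ≡ Vec.lookup B s′
      at s′ = decide ((γ s′ ≟ᶠ o) ×-dec any? (λ s → (s ∈? Y) ×-dec Supp? (δ s a) s′))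
        where
        decide : (d : Dec (γ s′ ≡ o × ∃ λ s → s ∈ˢ Y × Supp (δ s a) s′)) → does d ≡ Vec.lookup B s′
        decide (yes p) = ≡.sym ([]=⇒lookup (complete s′ p))
        decide (no ¬p) with Vec.lookup B s′ in eq
        ... | false = ≡.refl
        ... | true  = ⊥-elim (¬p (sound s′ (lookup⇒[]= s′ B eq)))

  -- States s₀, X, Y, Z are 0F, …, 3F. Only Z has an odd priority and it is avoided
  -- from X by playing 0F, 1F, 0F, … and from Y by playing 1F, 0F, 1F, …, but from
  -- the second step on the belief is always {X, Y, Z}.
  module Example where

    Succ : Fin 4 → Fin 2 → Fin 4 → Set
    Succ 0F _  s′ = s′ ≢ 0F
    Succ 1F 0F s′ = s′ ≡ 2F
    Succ 1F 1F s′ = s′ ≡ 3F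
    Succ 2F 0F s′ = s′ ≡ 3F
    Succ 2F 1F s′ = s′ ≡ 1F
    Succ 3F _  s′ = s′ ≢ 0F

    ∃Succ : ∀ s a → ∃ (Succ s a)
    ∃Succ 0F _  = 3F , λ ()
    ∃Succ 1F 0F = 2F , ≡.refl
    ∃Succ 1F 1F = 3F , ≡.refl
    ∃Succ 2F 0F = 3F , ≡.refl
    ∃Succ 2F 1F = 1F , ≡.refl
    ∃Succ 3F _  = 3F , λ ()

    Succ≢s₀ : ∀ s a {s′} → Succ s a s′ → s′ ≢ 0F
    Succ≢s₀ 0F _  s≢ eq = s≢ eq
    Succ≢s₀ 1F 0F ≡.refl ()
    Succ≢s₀ 1F 1F ≡.refl ()
    Succ≢s₀ 2F 0F ≡.refl ()
    Succ≢s₀ 2F 1F ≡.refl ()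
    Succ≢s₀ 3F _  s≢ eq = s≢ eq

    γ : Fin 4 → Fin 2
    γ 0F      = 0F
    γ (suc _) = 1F

    γ-initial : ∀ s → γ s ≡ γ 0F → s ≡ 0F
    γ-initial 0F _ = ≡.refl

    graph : Graph
    graph = record
      { |S| = 4 ; |A| = 2 ; |O| = 2 ; Succ = Succ ; ∃Succ = ∃Succ
      ; γ = γ ; s₀ = 0F ; γ-initial = γ-initial }

    open Graph graph using (Supp⁺; Supp⁻)

    G : POMDP
    G = Graph.pomdp graph

    p : Fin 4 → ℕ
    p 3F = 1
    p _  = 2

    π : PriorityFunction G
    π = record
      { D = 2 ∷ 1 ∷ [] ; D-unique = ((λ ()) ∷ []) ∷ [] ∷ [] ; p = p
      ; p∈D = λ { 0F → here ≡.refl ; 1F → here ≡.refl ; 2F → here ≡.refl ; 3F → there (here ≡.refl) } }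

    flip : Fin 2 → Fin 2
    flip 0F = 1F
    flip 1F = 0F

    σ : FMStrategy G
    σ = record { |M| = 2 ; m₀ = 0F ; σn = point ; σu = λ m _ _ → point (flip m) }

    module Alternating where

      open StrategyChain G π σ

      Step⁺ : ∀ {s s′} m → Succ s m s′ → Step (s , m) (s′ , flip m)
      Step⁺ {s} m succ = m , Supp-point m , Supp⁺ {s} {m} succ , Supp-point (flip m)

      Step⁻ : ∀ {s m s′ m′} → Step (s , m) (s′ , m′) → Succ s m s′ × m′ ≡ flip m
      Step⁻ {s} {m} (a , a∈ , δ>0 , u>0) with ≡.refl ← Supp-point⁻ {i = m} {a} a∈ = Supp⁻ {s} {a} δ>0 , Supp-point⁻ u>0

      move-to : ∀ {s s′ y} m → Succ s m s′ → Reach (s′ , flip m) y → Reach (s , m) y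
      move-to {s} {s′} m succ r = Step⇒δσ-pos {s , m} {s′ , flip m} (Step⁺ {s} {s′} m succ) ◅ r

      -- The alternating action agrees with the hidden state; from such a pair the run moves between
      -- X and Y forever.
      data InPhase : X → Set where
        at-X : InPhase (1F , 0F)
        at-Y : InPhase (2F , 1F)

      InPhase-Step : ∀ {x} y → InPhase x → Step x y → InPhase y
      InPhase-Step (s , m) at-X step with ≡.refl , ≡.refl ← Step⁻ {1F} {0F} {s} {m} step = at-Y
      InPhase-Step (s , m) at-Y step with ≡.refl , ≡.refl ← Step⁻ {2F} {1F} {s} {m} step = at-X

      InPhase-Reach : ∀ {x y} → InPhase x → Reach x y → InPhase y
      InPhase-Reach ok done = ok
      InPhase-Reach {x} ok (_◅_ {j = z} e es) = InPhase-Reach (InPhase-Step z ok (δσ-pos⇒Step {x} {z} e)) es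

      InPhase-p : ∀ {x} → InPhase x → p (proj₁ x) ≡ 2
      InPhase-p at-X = ≡.refl
      InPhase-p at-Y = ≡.refl

      Good-2 : ∀ {x} → InPhase x → Good 2 x
      Good-2 ok = divides 1 ≡.refl ,
        (λ y r → ℕ.≤-reflexive (≡.sym (InPhase-p (InPhase-Reach ok r)))) ,
        (λ y r → y , done , InPhase-p (InPhase-Reach ok r))

      -- Out of phase the next action leads to Z, and Z may move to whichever of X and Y matches the
      -- phase.
      canWin : ∀ x → CanWin x
      canWin (0F , 0F) = (2F , 1F) , move-to {s′ = 2F} 0F (λ ()) done , 2 , Good-2 at-Y
      canWin (0F , 1F) = (1F , 0F) , move-to {s′ = 1F} 1F (λ ()) done , 2 , Good-2 at-X
      canWin (1F , 0F) = (1F , 0F) , done , 2 , Good-2 at-X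
      canWin (1F , 1F) = (2F , 1F) , move-to {s′ = 3F} 1F ≡.refl (move-to {s′ = 2F} 0F (λ ()) done) , 2 , Good-2 at-Y
      canWin (2F , 0F) = (1F , 0F) , move-to {s′ = 3F} 0F ≡.refl (move-to {s′ = 1F} 1F (λ ()) done) , 2 , Good-2 at-X
      canWin (2F , 1F) = (2F , 1F) , done , 2 , Good-2 at-Y
      canWin (3F , 0F) = (2F , 1F) , move-to {s′ = 2F} 0F (λ ()) done , 2 , Good-2 at-Y
      canWin (3F , 1F) = (1F , 0F) , move-to {s′ = 1F} 1F (λ ()) done , 2 , Good-2 at-X

      winning : ∀ mode → Winning G mode π σ
      winning almost-sure = canWin⇒winning almost-sure λ x _ → canWin x
      winning positive    = canWin⇒winning positive (canWin (0F , 0F))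

    module NoBelief (b : BeliefStrategy G) where

      open BeliefChain G π b

      XYZ : Subset 4
      XYZ = outside ∷ inside ∷ inside ∷ inside ∷ []

      ∈XYZ : ∀ s → s ≢ 0F → s ∈ˢ XYZ
      ∈XYZ s s≢0 = lookup⇒[]= s XYZ (at s s≢0)
        where
        at : ∀ s → s ≢ 0F → Vec.lookup XYZ s ≡ inside
        at 0F s≢ = ⊥-elim (s≢ ≡.refl)
        at 1F _ = ≡.refl
        at 2F _ = ≡.refl
        at 3F _ = ≡.refl

      XYZ∌0 : ∀ {s} → s ∈ˢ XYZ → s ≢ 0F
      XYZ∌0 {0F} 0∈ _ with () ← []=⇒lookup 0∈

      γ≡1⇒≢0 : ∀ s → γ s ≡ 1F → s ≢ 0F
      γ≡1⇒≢0 0F ()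
      γ≡1⇒≢0 (suc _) _ ()

      ≢0⇒γ≡1 : ∀ s → s ≢ 0F → γ s ≡ 1F
      ≢0⇒γ≡1 0F s≢ = ⊥-elim (s≢ ≡.refl)
      ≢0⇒γ≡1 (suc _) _ = ≡.refl

      -- One state of the belief that may move anywhere fills it: `s₀` at the start, and Z ever
      -- after.
      update-XYZ : ∀ Y a {z} → z ∈ˢ Y → (∀ {s} → s ≢ 0F → Succ z a s) → updateBelief G Y 1F a ≡ XYZ
      update-XYZ Y a {z} z∈Y succ = updateBelief-≡ G Y 1F a XYZ
        (λ s s∈ → ≢0⇒γ≡1 s (XYZ∌0 s∈) , z , z∈Y , Supp⁺ {z} {a} (succ (XYZ∌0 s∈)))
        (λ s p → ∈XYZ s (γ≡1⇒≢0 s (proj₁ p)))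

      data Reached : X → Set where
        initially : Reached (0F , initialBelief G)
        later     : ∀ {s} → s ≢ 0F → Reached (s , XYZ)

      update-Reached : ∀ {s Y} → Reached (s , Y) → ∀ a → updateBelief G Y 1F a ≡ XYZ
      update-Reached initially a = update-XYZ (initialBelief G) a (x∈⁅x⁆ 0F) (λ s≢ → s≢)
      update-Reached (later _) a = update-XYZ XYZ a (∈XYZ 3F (λ ())) (λ s≢ → s≢)

      Reached-Step : ∀ {x y} → Reached x → Step x y → Reached y
      Reached-Step {s , Y} {s′ , Y′} r step with a , δ>0 , eq ← belief-Step⁻ {s} {Y} {s′} {Y′} step
        with s′≢0 ← Succ≢s₀ s a (Supp⁻ {s} {a} δ>0) = ≡.subst (λ Y → Reached (s′ , Y)) (≡.sym Y′≡) (later s′≢0)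
        where
        Y′≡ : Y′ ≡ XYZ
        Y′≡ = ≡.trans eq (≡.trans (≡.cong (λ o → updateBelief G Y o a) (≢0⇒γ≡1 s′ s′≢0)) (update-Reached r a))

      Reached-Reach : ∀ {x y} → Reached x → Reach x y → Reached y
      Reached-Reach r done     = r
      Reached-Reach {x} r (_◅_ {j = z} e es) = Reached-Reach (Reached-Step {x} {z} r (δσ-pos⇒Step {x} {z} e)) es

      step-to : ∀ {s Y a y} s′ → Reached (s , Y) → Supp (b Y) a → Succ s a s′ → Reach (s′ , XYZ) y → Reach (s , Y) y
      step-to {s} {Y} {a} s′ r a∈ succ es =
        Step⇒δσ-pos {s , Y} {s′ , XYZ} (belief-Step⁺ {s} {Y} {s′} {XYZ} {a} a∈ (Supp⁺ {s} {a} succ)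
          (≡.sym (≡.trans (≡.cong (λ o → updateBelief G Y o a) (≢0⇒γ≡1 s′ (Succ≢s₀ s a succ))) (update-Reached r a)))) ◅ es

      -- At the constant belief one fixed action can be repeated forever: 0F leads from X through Y
      -- to Z, and 1F from Y through X to Z.
      reach-Z : ∀ {x} → Reached x → Reach x (3F , XYZ)
      reach-Z initially = let a , a∈ = Supp-nonempty (b (initialBelief G)) in step-to 3F initially a∈ (λ ()) done
      reach-Z (later {s} s≢0) = let a , a∈ = Supp-nonempty (b XYZ) in from s a s≢0 a∈
        where
        from : ∀ s a → s ≢ 0F → Supp (b XYZ) a → Reach (s , XYZ) (3F , XYZ)
        from 0F a  s≢ a∈ = ⊥-elim (s≢ ≡.refl)
        from 1F 0F s≢ a∈ = step-to 2F (later s≢) a∈ ≡.refl (step-to 3F (later λ ()) a∈ ≡.refl done)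
        from 1F 1F s≢ a∈ = step-to 3F (later s≢) a∈ ≡.refl done
        from 2F 0F s≢ a∈ = step-to 3F (later s≢) a∈ ≡.refl done
        from 2F 1F s≢ a∈ = step-to 1F (later s≢) a∈ ≡.refl (step-to 3F (later λ ()) a∈ ≡.refl done)
        from 3F a  s≢ a∈ = done

      p≢0 : ∀ s → p s ≢ 0
      p≢0 0F ()
      p≢0 1F ()
      p≢0 2F ()
      p≢0 3F ()

      -- Reaching Z forces `k` to be at most 1, but no state has priority 0 and 1 is odd.
      ¬Good : ∀ {k x} → Reached x → ¬ Good k x
      ¬Good {k} {x} r (even , lower , hit) with lower _ (reach-Z r)
      ... | z≤n     = p≢0 _ (proj₂ (proj₂ (hit x done)))
      ... | s≤s z≤n with () ← ∣1⇒≡1 even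

      ¬canWin : ¬ CanWin (0F , initialBelief G)
      ¬canWin (y , r , k , good) = ¬Good (Reached-Reach initially r) good

      losing : ∀ mode → ¬ BeliefWinning G mode π b
      losing almost-sure win = ¬canWin (winning⇒canWin almost-sure win _ done)
      losing positive    win = ¬canWin (winning⇒canWin positive win)

  belief-insufficient : ∀ mode → ∃ λ (G : POMDP) → ∃ λ (π : PriorityFunction G) →
    (∃ λ σ → Winning G mode π σ) × ¬ (∃ λ b → BeliefWinning G mode π b)
  belief-insufficient mode = G , π , (σ , Alternating.winning mode) , λ { (b , win) → NoBelief.losing b mode win }
    where open Example

-- A family that needs exponential memory

module ExpMem (em : ExcludedMiddle 0ℓ) (ℝ : CompleteOrderedField) where

  open Reals ℝ
  open POMDPs ℝ
  open Strat em ℝ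
  open Dists em ℝ
  open Belief em ℝ using (finToFun-injective; module Example)
  open Example using (flip)

  flip-involutive : ∀ b → flip (flip b) ≡ b
  flip-involutive 0F = ≡.refl
  flip-involutive 1F = ≡.refl

  -- A run picks a hidden i and keeps a hidden bit, initially 0. It issues random
  -- challenges j, which are observed; j = suc i requires the current bit as the next
  -- action and inverts the bit. As i is unknown, a winning controller has to
  -- remember the parity of the number of challenges suc i for every i.
  module Family (n : ℕ) where

    -- Challenge 0F tests no hidden index. It accounts for the `suc` in `Fin (suc n)` and is the
    -- resting point between tests in the lower bound.
    data View : Set where
      start fail : View
      run        : (i : Fin n) (b : Fin 2) (j : Fin (suc n)) → View

    |St| : ℕ
    |St| = 2 +ℕ n *ℕ (2 *ℕ suc n)

    encode : View → Fin |St|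
    encode start       = 0F
    encode fail        = 1F
    encode (run i b j) = suc (suc (combine i (combine b j)))

    decode : Fin |St| → View
    decode 0F = start
    decode 1F = fail
    decode (suc (suc k)) = let i , r = remQuot {n} (2 *ℕ suc n) k
                               b , j = remQuot {2} (suc n) r
                           in run i b j

    decode-encode : ∀ x → decode (encode x) ≡ x
    decode-encode start = ≡.refl
    decode-encode fail  = ≡.refl
    decode-encode (run i b j) = ≡.trans
      (≡.cong (λ q → let b , j = remQuot {2} (suc n) (proj₂ q) in run (proj₁ q) b j) (remQuot-combine i (combine b j)))
      (≡.cong (λ r → run i (proj₁ r) (proj₂ r)) (remQuot-combine b j))

    next-bit : Fin n → Fin (suc n) → Fin 2 → Fin 2
    next-bit i j b = if does (j ≟ᶠ suc i) then flip b else b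

    -- `fail` is absorbing and the only view of odd priority, so winning means never entering it.
    -- `reset` makes `start` reachable from every good state, and `wait` gives `start` a successor
    -- even for `n = 0`.
    data Move : View → Fin 2 → View → Set where
      wait   : ∀ {a} → Move start a start
      launch : ∀ {a} i → Move start a (run i 0F 0F)
      stuck  : ∀ {a} → Move fail a fail
      wrong  : ∀ {a i b j} → j ≡ suc i → a ≢ b → Move (run i b j) a fail
      reset  : ∀ {a i b j} → (j ≡ suc i → a ≡ b) → Move (run i b j) a start
      go     : ∀ {a i b j} j′ → (j ≡ suc i → a ≡ b) → Move (run i b j) a (run i (next-bit i j b) j′)

    respond : ∀ i b j a → ∃ (Move (run i b j) a)
    respond i b j a with j ≟ᶠ suc i | a ≟ᶠ b
    ... | yes eq | no a≢b = fail , wrong eq a≢b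
    ... | no ¬eq | _      = start , reset (⊥-elim ∘ ¬eq)
    ... | yes _  | yes eq = start , reset (λ _ → eq)

    ∃Move : ∀ x a → ∃ (Move x a)
    ∃Move start       a = start , wait
    ∃Move fail        a = fail , stuck
    ∃Move (run i b j) a = respond i b j a

    observe : View → Fin (2 +ℕ suc n)
    observe start       = 0F
    observe fail        = 1F
    observe (run _ _ j) = suc (suc j)

    Succ : Fin |St| → Fin 2 → Fin |St| → Set
    Succ s a s′ = Move (decode s) a (decode s′)

    ∃Succ : ∀ s a → ∃ (Succ s a)
    ∃Succ s a with x , mv ← ∃Move (decode s) a = encode x , ≡.subst (Move (decode s) a) (≡.sym (decode-encode x)) mv

    γ-initial : ∀ s → observe (decode s) ≡ 0F → s ≡ 0F
    γ-initial 0F _ = ≡.refl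
    γ-initial 1F ()
    γ-initial (suc (suc _)) ()

    graph : Graph
    graph = record
      { |S| = |St| ; |A| = 2 ; |O| = 2 +ℕ suc n ; Succ = Succ ; ∃Succ = ∃Succ
      ; γ = observe ∘ decode ; s₀ = 0F ; γ-initial = γ-initial }

    open Graph graph using (Supp⁺; Supp⁻)

    G : POMDP
    G = Graph.pomdp graph

    priority : View → ℕ
    priority fail = 1
    priority _    = 0

    priority∈ : ∀ x → priority x ∈ 0 ∷ 1 ∷ []
    priority∈ start       = here ≡.refl
    priority∈ fail        = there (here ≡.refl)
    priority∈ (run _ _ _) = here ≡.refl

    π : PriorityFunction G
    π = record { D = 0 ∷ 1 ∷ [] ; D-unique = ((λ ()) ∷ []) ∷ [] ∷ [] ; p = priority ∘ decode ; p∈D = priority∈ ∘ decode }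

    module Tracking where

      -- One bit for every candidate `i`, as the true one is never observed, and the challenge to be
      -- answered next.
      |Mem| : ℕ
      |Mem| = 2 ^ n *ℕ suc n

      bits : Fin |Mem| → Fin n → Fin 2
      bits m = finToFun (proj₁ (remQuot {2 ^ n} (suc n) m))

      challenge : Fin |Mem| → Fin (suc n)
      challenge m = proj₂ (remQuot {2 ^ n} (suc n) m)

      store : (Fin n → Fin 2) → Fin (suc n) → Fin |Mem|
      store v j = combine (funToFin v) j

      bits-store : ∀ v j i → bits (store v j) i ≡ v i
      bits-store v j i = ≡.trans (≡.cong (λ q → finToFun (proj₁ q) i) (remQuot-combine (funToFin v) j)) (finToFun-funToFin v i)

      challenge-store : ∀ v j → challenge (store v j) ≡ j
      challenge-store v j = ≡.cong proj₂ (remQuot-combine (funToFin v) j)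

      answer : (Fin n → Fin 2) → Fin (suc n) → Fin 2
      answer v zero    = 0F
      answer v (suc t) = v t

      next-memory : Fin |Mem| → Fin (2 +ℕ suc n) → Fin |Mem|
      next-memory m (suc (suc j)) = store (λ i → next-bit i (challenge m) (bits m i)) j
      next-memory m _             = store (λ _ → 0F) 0F

      σ : FMStrategy G
      σ = record
        { |M| = |Mem| ; m₀ = store (λ _ → 0F) 0F
        ; σn = λ m → point (answer (bits m) (challenge m)) ; σu = λ m o _ → point (next-memory m o) }

      open StrategyChain G π σ

      Consistent : View → Fin |Mem| → Set
      Consistent start       m = (∀ i → bits m i ≡ 0F) × challenge m ≡ 0F
      Consistent fail        m = ⊥
      Consistent (run i b j) m = bits m i ≡ b × challenge m ≡ j

      answer-challenge : ∀ {v j i} → j ≡ suc i → answer v j ≡ v i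
      answer-challenge ≡.refl = ≡.refl

      consistent-start : Consistent start (store (λ _ → 0F) 0F)
      consistent-start = bits-store (λ _ → 0F) 0F , challenge-store (λ _ → 0F) 0F

      consistent-Move : ∀ {x a x′} m → Consistent x m → a ≡ answer (bits m) (challenge m) → Move x a x′ →
                        Consistent x′ (next-memory m (observe x′))
      consistent-Move m c eq wait = consistent-start
      consistent-Move m (zeros , ch) eq (launch i) =
        ≡.trans (bits-store _ 0F i) (≡.trans (≡.cong (λ j → next-bit i j (bits m i)) ch) (zeros i)) , challenge-store _ 0F
      consistent-Move m (bit , ch) eq (wrong j≡ a≢b) =
        a≢b (≡.trans eq (≡.trans (answer-challenge (≡.trans ch j≡)) bit))
      consistent-Move m c eq (reset _) = consistent-start
      consistent-Move m (bit , ch) eq (go {i = i} j′ _) =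
        ≡.trans (bits-store _ j′ i) (≡.cong₂ (next-bit i) ch bit) , challenge-store _ j′

      consistent-Step : ∀ {x y} → Consistent (decode (proj₁ x)) (proj₂ x) → Step x y → Consistent (decode (proj₁ y)) (proj₂ y)
      consistent-Step {s , m} {s′ , m′} c (a , a∈ , δ>0 , u>0) =
        ≡.subst (Consistent (decode s′)) (≡.sym (Supp-point⁻ u>0))
          (consistent-Move m c (Supp-point⁻ a∈) (Supp⁻ {s} {a} δ>0))

      consistent-Reach : ∀ {x y} → Consistent (decode (proj₁ x)) (proj₂ x) → Reach x y → Consistent (decode (proj₁ y)) (proj₂ y)
      consistent-Reach c done = c
      consistent-Reach {x} c (_◅_ {j = z} e es) = consistent-Reach (consistent-Step {x} {z} c (δσ-pos⇒Step {x} {z} e)) es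

      consistent-priority : ∀ x m → Consistent x m → priority x ≡ 0
      consistent-priority start       m _ = ≡.refl
      consistent-priority (run _ _ _) m _ = ≡.refl

      canWin : ∀ x → Consistent (decode (proj₁ x)) (proj₂ x) → CanWin x
      canWin x c = x , done , 0 , divides 0 ≡.refl , (λ _ _ → z≤n) ,
        λ y r → y , done , consistent-priority (decode (proj₁ y)) (proj₂ y) (consistent-Reach c r)

      winning : ∀ mode → Winning G mode π σ
      winning almost-sure = canWin⇒winning almost-sure λ x r → canWin x (consistent-Reach consistent-start r)
      winning positive    = canWin⇒winning positive (canWin _ consistent-start)

    module LowerBound (σ : FMStrategy G) where

      open FMStrategy σ
      open StrategyChain G π σ

      at : View → Fin |M| → X
      at x m = encode x , m

      Move-Step : ∀ {x x′ m m′ a} → Move x a x′ → Supp (σn m) a → Supp (σu m (observe x′) a) m′ → Step (at x m) (at x′ m′)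
      Move-Step {x} {x′} {m} {m′} {a} mv a∈ m′∈ = a , a∈ ,
        Supp⁺ {encode x} {a} (≡.subst₂ (λ x x′ → Move x a x′) (≡.sym (decode-encode x)) (≡.sym (decode-encode x′)) mv) ,
        ≡.subst (λ x → Supp (σu m (observe x) a) m′) (≡.sym (decode-encode x′)) m′∈

      module _ (x : X) (k : ℕ) (good : Good k x) where

        extend : ∀ {y z} → Reach x y → Step y z → Reach x z
        extend {y} {z} r st = r ◅◅ (Step⇒δσ-pos {y} {z} st ◅ done)

        fail-stuck : ∀ {y z} → decode (proj₁ y) ≡ fail → Reach y z → decode (proj₁ z) ≡ fail
        fail-stuck eq done = eq
        fail-stuck {s , m} eq (_◅_ {j = z} e es) with a , _ , δ>0 , _ ← δσ-pos⇒Step {s , m} {z} e =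
          fail-stuck (from eq (Supp⁻ {s} {a} δ>0)) es
          where
          from : ∀ {y z a} → y ≡ fail → Move y a z → z ≡ fail
          from ≡.refl stuck = ≡.refl

        -- From the absorbing `fail` only priority 1 is reachable, which is odd, whereas a good
        -- state needs the even `k` there.
        no-fail : ∀ {s m} → decode s ≡ fail → ¬ Reach x (s , m)
        no-fail {s} {m} eq r with z , y→z , pz ← proj₂ (proj₂ good) (s , m) r
          with () ← ∣1⇒≡1 (≡.subst (2 ∣_) (≡.trans (≡.sym pz) (≡.cong priority (fail-stuck eq y→z))) (proj₁ good))

        correct : ∀ {i b j m a} → Reach x (at (run i b j) m) → Supp (σn m) a → j ≡ suc i → a ≡ b
        correct {i} {b} {j} {m} {a} r a∈ j≡ = decidable-stable (a ≟ᶠ b) λ a≢b →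
          let m′ , m′∈ = Supp-nonempty (σu m 1F a) in
          no-fail ≡.refl (extend r (Move-Step (wrong j≡ a≢b) a∈ m′∈))

        -- All `n` hidden indices are possible at one and the same memory state `m`, index `i` with
        -- bit `v i`. Hence `m` has to encode the whole vector `v`.
        Live : (Fin n → Fin 2) → Fin |M| → Set
        Live v m = ∀ i → Reach x (at (run i (v i) 0F) m)

        reach-start : ∃ λ m → Reach x (at start m)
        reach-start = from (proj₁ x) (proj₂ x) done
          where
          from : ∀ s m → Reach x (s , m) → ∃ λ m → Reach x (at start m)
          from s m r with decode s in eq
          ... | start = m , ≡.subst (λ s → Reach x (s , m)) (γ-initial s (≡.cong observe eq)) r
          ... | fail  = ⊥-elim (no-fail eq r)
          ... | run i b j = m′ , extend r (a , a∈ , Supp⁺ {s} {a} (≡.subst (λ y → Move y a start) (≡.sym eq) (reset ok)) , m′∈)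
            where
            a  = proj₁ (Supp-nonempty (σn m))
            a∈ = proj₂ (Supp-nonempty (σn m))
            m′ = proj₁ (Supp-nonempty (σu m 0F a))
            m′∈ = proj₂ (Supp-nonempty (σu m 0F a))
            ok : j ≡ suc i → a ≡ b
            ok j≡ = decidable-stable (a ≟ᶠ b) λ a≢b →
              let m₁ , m₁∈ = Supp-nonempty (σu m 1F a) in
              no-fail ≡.refl (extend {z = at fail m₁} r (a , a∈ , Supp⁺ {s} {a} (≡.subst (λ y → Move y a fail) (≡.sym eq) (wrong j≡ a≢b)) , m₁∈))

        live-zero : ∃ (Live (λ _ → 0F))
        live-zero =
          let m , r   = reach-start
              a , a∈  = Supp-nonempty (σn m)
              m′ , m′∈ = Supp-nonempty (σu m (suc (suc 0F)) a)
          in m′ , λ i → extend r (Move-Step (launch i) a∈ m′∈)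

        Challenged : (Fin n → Fin 2) → Fin n → Fin |M| → Set
        Challenged v t m = ∀ i → Reach x (at (run i (v i) (suc t)) m)

        -- The same memory state results for all v.
        challenged : ∀ m t → ∃ λ m′ → ∀ v → Live v m → Challenged v t m′
        challenged m t =
          let a , a∈   = Supp-nonempty (σn m)
              m′ , m′∈ = Supp-nonempty (σu m (suc (suc (suc t))) a)
          in m′ , λ v live i → extend (live i) (Move-Step {run i (v i) 0F} (go (suc t) λ ()) a∈ m′∈)

        -- Challenge `suc t` leads from `m` to one memory state for both vectors, and any answer
        -- given there has to equal both `v t` and `w t`.
        Live-injective : ∀ {v w m} → Live v m → Live w m → ∀ t → v t ≡ w t
        Live-injective {v} {w} {m} live-v live-w t =
          let m′ , ch = challenged m t
              a , a∈  = Supp-nonempty (σn m′)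
          in ≡.trans (≡.sym (correct (ch v live-v t) a∈ ≡.refl)) (correct (ch w live-w t) a∈ ≡.refl)

        toggle : Fin n → (Fin n → Fin 2) → Fin n → Fin 2
        toggle t v i = next-bit i (suc t) (v i)

        -- Posing `suc t` and then 0F inverts the bit of index `t` alone. The controller sees the
        -- same observations for every hidden index, so one choice of actions and updates works for
        -- all.
        live-toggle : ∀ {v m} t → Live v m → ∃ (Live (toggle t v))
        live-toggle {v} {m} t live =
          let m₁ , ch  = challenged m t
              a , a∈   = Supp-nonempty (σn m₁)
              m₂ , m₂∈ = Supp-nonempty (σu m₁ (suc (suc 0F)) a)
          in m₂ , λ i → extend (ch v live i) (Move-Step {run i (v i) (suc t)} (go 0F (correct (ch v live i) a∈)) a∈ m₂∈)

        Live-≗ : ∀ {v w m} → (∀ i → v i ≡ w i) → Live v m → Live w m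
        Live-≗ {m = m} eq live i = ≡.subst (λ b → Reach x (at (run i b 0F) m)) (eq i) (live i)

        toggle-toggle : ∀ t v i → toggle t (toggle t v) i ≡ v i
        toggle-toggle t v i with t ≟ᶠ i
        ... | yes _ = flip-involutive (v i)
        ... | no _  = ≡.refl

        toggle-at : ∀ t v → toggle t v t ≡ flip (v t)
        toggle-at t v with t ≟ᶠ t
        ... | yes _ = ≡.refl
        ... | no ¬eq = ⊥-elim (¬eq ≡.refl)

        toggle-off : ∀ t v i → t ≢ i → toggle t v i ≡ v i
        toggle-off t v i t≢i with t ≟ᶠ i
        ... | yes eq = ⊥-elim (t≢i eq)
        ... | no _   = ≡.refl

        -- Induction on the number `k` of leading positions that may be 1. A 1 at the last of these
        -- is obtained by one challenge from the vector with a 0 there.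
        all-live-below : ∀ k → k ≤ℕ n → ∀ v → (∀ i → k ≤ℕ toℕ i → v i ≡ 0F) → ∃ (Live v)
        all-live-below zero    _   v zeros = proj₁ live-zero , Live-≗ (λ i → ≡.sym (zeros i z≤n)) (proj₂ live-zero)
        all-live-below (suc k) k<n v zeros = by-bit (v t) ≡.refl
          where
          t : Fin n
          t = fromℕ< k<n
          zeros-off : ∀ i → k ≤ℕ toℕ i → t ≢ i → v i ≡ 0F
          zeros-off i k≤i t≢i = zeros i (ℕ.≤∧≢⇒< k≤i λ k≡i → t≢i (toℕ-injective (≡.trans (toℕ-fromℕ< k<n) k≡i)))
          below : ∀ w → w t ≡ 0F → (∀ i → t ≢ i → w i ≡ v i) → ∃ (Live w)
          below w wt≡0 same = all-live-below k (ℕ.<⇒≤ k<n) w zeros-w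
            where
            zeros-w : ∀ i → k ≤ℕ toℕ i → w i ≡ 0F
            zeros-w i k≤i with t ≟ᶠ i
            ... | yes ≡.refl = wt≡0
            ... | no t≢i     = ≡.trans (same i t≢i) (zeros-off i k≤i t≢i)
          by-bit : ∀ b → v t ≡ b → ∃ (Live v)
          by-bit 0F vt≡0 = below v vt≡0 (λ _ _ → ≡.refl)
          by-bit 1F vt≡1 =
            let m , live = below (toggle t v) (≡.trans (toggle-at t v) (≡.cong flip vt≡1)) (toggle-off t v)
                m′ , live′ = live-toggle t live
            in m′ , Live-≗ (toggle-toggle t v) live′

        all-live : ∀ v → ∃ (Live v)
        all-live v = all-live-below n ℕ.≤-refl v λ i n≤i → ⊥-elim (ℕ.<⇒≱ (toℕ<n i) n≤i)

        memory-of : Fin (2 ^ n) → Fin |M|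
        memory-of k = proj₁ (all-live (finToFun k))

        memory-of-injective : ∀ {k l} → memory-of k ≡ memory-of l → k ≡ l
        memory-of-injective {k} {l} eq = finToFun-injective
          (Live-injective (≡.subst (Live (finToFun k)) eq (proj₂ (all-live (finToFun k)))) (proj₂ (all-live (finToFun l))))

        2^n≤|M| : 2 ^ n ≤ℕ |M|
        2^n≤|M| = injective⇒≤ memory-of-injective

      memory-bound : ∀ mode → Winning G mode π σ → 2 ^ n ≤ℕ |M|
      memory-bound mode win = let x , _ , k , good = canWin₀ mode (winning⇒canWin mode win) in 2^n≤|M| x k good
        where
        canWin₀ : ∀ mode → CanWin-in mode → CanWin (0F , m₀)
        canWin₀ almost-sure w = w _ done
        canWin₀ positive    w = w

  open Family using (G; π)

  -- The constant 6 is the number of states for `n = 1`. With `n = suc m` the gap is the polynomial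
  -- `6 * m + 4 * m * m`, added explicitly for the solver.
  |St|≤ : ∀ m → Family.|St| (suc m) ≤ℕ 6 *ℕ suc m ^ 2
  |St|≤ m = ≡.subst (Family.|St| (suc m) ≤ℕ_)
    (solve 1 (λ m → con 2 :+ (con 1 :+ m) :* (con 2 :* (con 2 :+ m)) :+ (con 6 :* m :+ con 4 :* m :* m)
                    := con 6 :* (con 1 :+ m) :^ 2) ≡.refl m)
    (ℕ.m≤m+n _ _)
    where open +-*-Solver

  obs≤ : ∀ m → 3 +ℕ suc m ≤ℕ 6 *ℕ suc m ^ 2
  obs≤ m = ≡.subst (3 +ℕ suc m ≤ℕ_)
    (solve 1 (λ m → (con 4 :+ m) :+ (con 2 :+ con 11 :* m :+ con 6 :* m :* m)
                    := con 6 :* (con 1 :+ m) :^ 2) ≡.refl m)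
    (ℕ.m≤m+n _ _)
    where open +-*-Solver

  polynomial : PolynomialSize G π
  polynomial = 6 , 2 , size
    where
    size : ∀ n → 1 ≤ℕ n → SizeAtMost (G n) (6 *ℕ n ^ 2) (π n)
    size (suc m) _ = record
      { states = |St|≤ m ; actions = 2≤ ; observations = obs≤ m ; priorityCount = 2≤
      ; priorities = λ s → ℕ.≤-trans (priority≤1 (decode s)) 1≤2^N
      ; probabilities = rational }
      where
      open Family (suc m) using (View; start; fail; run; decode; priority; Succ; ∃Succ; |St|)
      N = 6 *ℕ suc m ^ 2
      2≤ : 2 ≤ℕ N
      2≤ = ℕ.≤-trans (s≤s (s≤s z≤n)) (obs≤ m)
      1≤2^N : 1 ≤ℕ 2 ^ N
      1≤2^N = ℕ.m^n>0 2 N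
      priority≤1 : ∀ x → priority x ≤ℕ 1
      priority≤1 start       = z≤n
      priority≤1 fail        = ℕ.≤-refl
      priority≤1 (run _ _ _) = z≤n
      n≤2^n : ∀ n → n ≤ℕ 2 ^ n
      n≤2^n zero    = z≤n
      n≤2^n (suc n) = ℕ.+-mono-≤ (ℕ.m^n>0 2 n) (ℕ.≤-trans (n≤2^n n) (ℕ.m≤m+n _ 0))
      rational : ∀ s a s′ → ∃ λ u → ∃ λ v → 1 ≤ℕ v × u ≤ℕ 2 ^ N × v ≤ℕ 2 ^ N × v · pr (POMDP.δ (G (suc m)) s a) s′ ≈ u · 1#
      rational s a s′ = let u , v , 1≤v , u≤1 , v≤S , eq = Uniform.uniform-rational (Succ s a) (∃Succ s a) s′ in
        u , v , 1≤v , ℕ.≤-trans u≤1 1≤2^N , ℕ.≤-trans v≤S (ℕ.≤-trans (|St|≤ m) (n≤2^n N)) , eq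

  exponential-memory : ∀ mode → ∃ λ (G : ℕ → POMDP) → ∃ λ (π : ∀ n → PriorityFunction (G n)) →
    PolynomialSize G π ×
    (∀ n → 1 ≤ℕ n → ∃ λ σ → Winning (G n) mode (π n) σ) ×
    (∃ λ (f : ℕ → ℕ) → AtLeastLinear f ×
      (∀ n → 1 ≤ℕ n → ∀ σ → Winning (G n) mode (π n) σ → 2 ^ f n ≤ℕ FMStrategy.|M| σ))
  exponential-memory mode = G , π , polynomial ,
    (λ n _ → Family.Tracking.σ n , Family.Tracking.winning n mode) ,
    (λ n → n) , (1 , 0 , λ n _ → ℕ.≤-reflexive (≡.sym (ℕ.*-identityˡ n))) ,
    λ n _ σ → Family.LowerBound.memory-bound n σ mode

open import Data.Nat using (_*_; _≤_)

theorem3 :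
  ExcludedMiddle 0ℓ → (ℝ : CompleteOrderedField) →
  let open POMDPs ℝ
      open POMDP using (|S|)
      open PriorityFunction using (d)
      open FMStrategy using (|M|) in
  ((G : POMDP) (π : PriorityFunction G) →
     (∃ λ σ → Winning G positive π σ) →
     ∃ λ σ → Winning G positive π σ × |M| σ ≤ 2 ^ (3 * d π * |S| G))
  ×
  ((G : POMDP) (π : PriorityFunction G) →
     (∃ λ σ → Winning G almost-sure π σ) →
     ∃ λ σ → Winning G almost-sure π σ × |M| σ ≤ 2 ^ (3 * d π * |S| G))
  ×
  ((mode : Mode) →
     (∃ λ (G : ℕ → POMDP) → ∃ λ (π : ∀ n → PriorityFunction (G n)) →
        PolynomialSize G π ×
        (∀ n → 1 ≤ n → ∃ λ σ → Winning (G n) mode (π n) σ) ×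
        (∃ λ (f : ℕ → ℕ) → AtLeastLinear f ×
           (∀ n → 1 ≤ n → ∀ σ → Winning (G n) mode (π n) σ → 2 ^ f n ≤ |M| σ)))
     ×
     (∃ λ (G : POMDP) → ∃ λ (π : PriorityFunction G) →
        (∃ λ σ → Winning G mode π σ) ×
        ¬ (∃ λ b → BeliefWinning G mode π b)))
theorem3 em ℝ =
  small-memory positive , small-memory almost-sure , λ mode → exponential-memory mode , belief-insufficient mode
  where

  open Quot em ℝ using (small-memory)
  open ExpMem em ℝ using (exponential-memory)
  open Belief em ℝ using (belief-insufficient)
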